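{- For any real $\alpha$ with $0<\alpha<\frac{3+\sqrt5}2$, no deterministic online algorithm (not necessarily monotone) for maximizing a non-negative monotone submodular function under a partition matroid constraint with free disposal, on instances of the form described in the context (all parts of capacity $1$), can have competitive ratio strictly larger than $\frac1\alpha$.
   Context: Instances: let $\mathcal{U}$ be a universe of items with weights $\nu:\mathcal{U}\to\mathbb{R}_+$, and $\nu(X):=\sum_{x\in X}\nu(x)$ for $X\subseteq\mathcal{U}$. For $i\ge0$ let $\Omega_i:=\{(u,i):u\in\mathcal{U}\}$ and let $\Omega:=\bigcup_{i\ge0}\Omega_i$. A (finite) set $S\subset\Omega$ is independent iff $|S\cap\Omega_i|\le1$ for all $i$ (a partition matroid with unit capacities). The objective is $f(S):=\nu(\{x:(x,i)\in S\text{ for some }i\})$, which is monotone submodular. Online problem with free disposal: distinct elements of $\Omega$ arrive one by one in a finite sequence whose length is unknown to the algorithm. The algorithm maintains an independent set $S$, initially empty. When $u$ arrives, it may remove elements from $S$ and may include $u$ in $S$, as long as $S$ remains independent; rejected or removed elements cannot be retrieved. The algorithm has a value oracle for $f$ and an independence oracle, only on sets of elements that have arrived so far, so the decisions of a deterministic algorithm are determined by this information. $\mathsf{OPT}$ is an independent set of elements of the sequence maximizing $f$. A deterministic algorithm has competitive ratio $r$ if for every instance and at the end of every finite sequence, $f(S)\ge r\cdot f(\mathsf{OPT})$. -}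

module Defs where

open import Data.Bool using (Bool; true; false)
open import Data.Fin.Subset using (Subset; inside; outside; _─_)
import Data.Integer as ℤ
import Data.Integer.Properties as ℤ
open import Data.List using (List; []; _∷_; length; filter; map; foldr; deduplicate)
open import Data.List.Membership.Propositional using (_∈_)
open import Data.List.Membership.Propositional.Properties using (∈-map⁺; ∈-filter⁻)
open import Data.List.Relation.Unary.All as All using (All)
open import Data.List.Relation.Unary.Any using (here)
open import Data.Nat as ℕ using (ℕ; zero; suc)
import Data.Nat.Properties as ℕ
import Data.Nat.Tactic.RingSolver as ℕSolver
open import Data.Product using (Σ-syntax; ∃-syntax; _×_; _,_; proj₁; proj₂)
open import Data.Rational as ℚ using (ℚ; mkℚ; 0ℚ; 1ℚ; ½; ∣_∣)
import Data.Rational.Properties as ℚ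
open import Data.Rational.Solver using (module +-*-Solver)
import Data.Rational.Unnormalised as ℚᵘ
import Data.Rational.Unnormalised.Properties as ℚᵘ
open import Data.Sum using (inj₁; inj₂)
open import Data.Vec using (Vec; []; _∷_)
open import Data.Vec.Relation.Unary.Unique.Propositional using (Unique)
open import Function using (_∘_)
open import Relation.Binary using (DecidableEquality)
open import Relation.Binary.PropositionalEquality
open import Relation.Nullary using (Dec; does; yes; no)
open import Relation.Nullary.Decidable using (map′)
open import Relation.Unary using (Pred)
open import Level using (0ℓ)

Eventually : Pred ℕ 0ℓ → Set
Eventually P = ∃[ N ] ∀ n → N ℕ.≤ n → P n

IsCauchy : (ℕ → ℚ) → Set
IsCauchy s = ∀ ε → 0ℚ ℚ.< ε →
  ∃[ N ] ∀ m n → N ℕ.≤ m → N ℕ.≤ n → ∣ s m ℚ.- s n ∣ ℚ.≤ ε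

record ℝ : Set where
  constructor mkℝ
  field
    seq    : ℕ → ℚ
    cauchy : IsCauchy seq

open ℝ public

infix 4 _<_ _≤_

_<_ : ℝ → ℝ → Set
x < y = ∃[ ε ] 0ℚ ℚ.< ε × Eventually (λ n → seq x n ℚ.+ ε ℚ.≤ seq y n)

_≤_ : ℝ → ℝ → Set
x ≤ y = ∀ ε → 0ℚ ℚ.< ε → Eventually (λ n → seq x n ℚ.≤ seq y n ℚ.+ ε)

private
  ⊔≤ˡ : ∀ m n {o} → m ℕ.⊔ n ℕ.≤ o → m ℕ.≤ o
  ⊔≤ˡ m n = ℕ.m⊔n≤o⇒m≤o m n

  ⊔≤ʳ : ∀ m n {o} → m ℕ.⊔ n ℕ.≤ o → n ℕ.≤ o
  ⊔≤ʳ m n = ℕ.m⊔n≤o⇒n≤o m n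

  ½* : ∀ {ε} → 0ℚ ℚ.< ε → 0ℚ ℚ.< ½ ℚ.* ε
  ½* {ε} ε>0 = subst (ℚ._< ½ ℚ.* ε) (ℚ.*-zeroʳ ½) (ℚ.*-monoʳ-<-pos ½ ε>0)

  ½+½ : ∀ ε → ½ ℚ.* ε ℚ.+ ½ ℚ.* ε ≡ ε
  ½+½ ε = trans (sym (ℚ.*-distribʳ-+ ε ½ ½)) (ℚ.*-identityˡ ε)

  *-mono-≤-nonNeg : ∀ {a b c d} → 0ℚ ℚ.≤ c → 0ℚ ℚ.≤ b →
                    a ℚ.≤ b → c ℚ.≤ d → a ℚ.* c ℚ.≤ b ℚ.* d
  *-mono-≤-nonNeg {a} {b} {c} {d} c≥0 b≥0 a≤b c≤d = ℚ.≤-trans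
    (ℚ.*-monoʳ-≤-nonNeg c {{ℚ.nonNegative c≥0}} a≤b)
    (ℚ.*-monoˡ-≤-nonNeg b {{ℚ.nonNegative b≥0}} c≤d)

  ∣-∣-≤ : ∀ {p q e} → p ℚ.≤ q ℚ.+ e → q ℚ.≤ p ℚ.+ e → ∣ p ℚ.- q ∣ ℚ.≤ e
  ∣-∣-≤ {p} {q} {e} h k with ℚ.∣p∣≡p∨∣p∣≡-p (p ℚ.- q)
  ... | inj₁ eq = subst₂ ℚ._≤_ (sym eq)
        (solve 2 (λ q e → q :+ e :- q := e) refl q e) (ℚ.+-monoˡ-≤ (ℚ.- q) h)
    where open +-*-Solver
  ... | inj₂ eq = subst₂ ℚ._≤_
        (trans (solve 2 (λ p q → q :- p := :- (p :- q)) refl p q) (sym eq))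
        (solve 2 (λ p e → p :+ e :- p := e) refl p e) (ℚ.+-monoˡ-≤ (ℚ.- p) k)
    where open +-*-Solver

  inv : (p : ℚ) → 0ℚ ℚ.< p → ℚ
  inv p p>0 = ℚ.1/_ p {{ℚ.>-nonZero p>0}}

  inv>0 : ∀ p p>0 → 0ℚ ℚ.< inv p p>0
  inv>0 p p>0 = ℚ.positive⁻¹ _ {{ℚ.1/pos⇒pos p {{ℚ.positive p>0}}}}

  *-inv : ∀ p p>0 → p ℚ.* inv p p>0 ≡ 1ℚ
  *-inv p p>0 = ℚ.*-inverseʳ p {{ℚ.>-nonZero p>0}}

  *-pos : ∀ {p q} → 0ℚ ℚ.< p → 0ℚ ℚ.< q → 0ℚ ℚ.< p ℚ.* q
  *-pos {p} {q} p>0 q>0 =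
    subst (ℚ._< p ℚ.* q) (ℚ.*-zeroʳ p) (ℚ.*-monoʳ-<-pos p {{ℚ.positive p>0}} q>0)

  bounded : ∀ x → ∃[ B ] 0ℚ ℚ.< B × Eventually (λ n → ∣ seq x n ∣ ℚ.≤ B)
  bounded x with cauchy x 1ℚ (ℚ.positive⁻¹ 1ℚ)
  ... | N , c = ∣ seq x N ∣ ℚ.+ 1ℚ
              , ℚ.+-mono-≤-< (ℚ.0≤∣p∣ (seq x N)) (ℚ.positive⁻¹ 1ℚ)
              , N , λ n N≤n → begin
      ∣ seq x n ∣                               ≡⟨ cong ∣_∣ (solve 2 (λ a b → b := a :+ (b :- a)) refl (seq x N) (seq x n)) ⟩
      ∣ seq x N ℚ.+ (seq x n ℚ.- seq x N) ∣     ≤⟨ ℚ.∣p+q∣≤∣p∣+∣q∣ (seq x N) (seq x n ℚ.- seq x N) ⟩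
      ∣ seq x N ∣ ℚ.+ ∣ seq x n ℚ.- seq x N ∣   ≤⟨ ℚ.+-monoʳ-≤ ∣ seq x N ∣ (c n N N≤n ℕ.≤-refl) ⟩
      ∣ seq x N ∣ ℚ.+ 1ℚ                        ∎
    where open ℚ.≤-Reasoning
          open +-*-Solver

fromℚ : ℚ → ℝ
fromℚ q = mkℝ (λ _ → q) λ ε ε>0 → 0 , λ _ _ _ _ →
  subst (λ d → ∣ d ∣ ℚ.≤ ε) (sym (ℚ.+-inverseʳ q)) (ℚ.<⇒≤ ε>0)

fromℕ : ℕ → ℝ
fromℕ n = fromℚ (ℤ.+ n ℚ./ 1)

0ℝ : ℝ
0ℝ = fromℕ 0

infixl 6 _+_
infixl 7 _*_

_+_ : ℝ → ℝ → ℝ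
x + y = mkℝ (λ n → seq x n ℚ.+ seq y n) λ ε ε>0 →
  let M , c = cauchy x (½ ℚ.* ε) (½* ε>0)
      N , d = cauchy y (½ ℚ.* ε) (½* ε>0)
  in M ℕ.⊔ N , λ m n h k → begin
    ∣ (seq x m ℚ.+ seq y m) ℚ.- (seq x n ℚ.+ seq y n) ∣
      ≡⟨ cong ∣_∣ (solve 4 (λ a b c d → (a :+ b) :- (c :+ d) := (a :- c) :+ (b :- d)) refl
           (seq x m) (seq y m) (seq x n) (seq y n)) ⟩
    ∣ (seq x m ℚ.- seq x n) ℚ.+ (seq y m ℚ.- seq y n) ∣
      ≤⟨ ℚ.∣p+q∣≤∣p∣+∣q∣ (seq x m ℚ.- seq x n) (seq y m ℚ.- seq y n) ⟩
    ∣ seq x m ℚ.- seq x n ∣ ℚ.+ ∣ seq y m ℚ.- seq y n ∣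
      ≤⟨ ℚ.+-mono-≤ (c m n (⊔≤ˡ M N h) (⊔≤ˡ M N k))
                    (d m n (⊔≤ʳ M N h) (⊔≤ʳ M N k)) ⟩
    ½ ℚ.* ε ℚ.+ ½ ℚ.* ε
      ≡⟨ ½+½ ε ⟩
    ε ∎
  where open ℚ.≤-Reasoning
        open +-*-Solver

_*_ : ℝ → ℝ → ℝ
x * y = mkℝ (λ n → seq x n ℚ.* seq y n) λ ε ε>0 →
  let B , B>0 , K , b = bounded x
      C , C>0 , L , c = bounded y
      δx = inv C C>0 ℚ.* (½ ℚ.* ε)
      δy = inv B B>0 ℚ.* (½ ℚ.* ε)
      M , d = cauchy x δx (*-pos (inv>0 C C>0) (½* ε>0))
      N , e = cauchy y δy (*-pos (inv>0 B B>0) (½* ε>0))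
      KL = K ℕ.⊔ L
      MN = M ℕ.⊔ N
  in KL ℕ.⊔ MN , λ m n h k → begin
    ∣ seq x m ℚ.* seq y m ℚ.- seq x n ℚ.* seq y n ∣
      ≡⟨ cong ∣_∣ (solve 4 (λ a b c d → a :* b :- c :* d := a :* (b :- d) :+ d :* (a :- c)) refl
           (seq x m) (seq y m) (seq x n) (seq y n)) ⟩
    ∣ seq x m ℚ.* (seq y m ℚ.- seq y n) ℚ.+ seq y n ℚ.* (seq x m ℚ.- seq x n) ∣
      ≤⟨ ℚ.∣p+q∣≤∣p∣+∣q∣ (seq x m ℚ.* (seq y m ℚ.- seq y n)) (seq y n ℚ.* (seq x m ℚ.- seq x n)) ⟩
    ∣ seq x m ℚ.* (seq y m ℚ.- seq y n) ∣ ℚ.+ ∣ seq y n ℚ.* (seq x m ℚ.- seq x n) ∣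
      ≡⟨ cong₂ ℚ._+_ (ℚ.∣p*q∣≡∣p∣*∣q∣ (seq x m) (seq y m ℚ.- seq y n))
                     (ℚ.∣p*q∣≡∣p∣*∣q∣ (seq y n) (seq x m ℚ.- seq x n)) ⟩
    ∣ seq x m ∣ ℚ.* ∣ seq y m ℚ.- seq y n ∣ ℚ.+ ∣ seq y n ∣ ℚ.* ∣ seq x m ℚ.- seq x n ∣
      ≤⟨ ℚ.+-mono-≤
           (*-mono-≤-nonNeg (ℚ.0≤∣p∣ (seq y m ℚ.- seq y n)) (ℚ.<⇒≤ B>0) (b m (⊔≤ˡ K L (⊔≤ˡ KL MN h)))
             (e m n (⊔≤ʳ M N (⊔≤ʳ KL MN h)) (⊔≤ʳ M N (⊔≤ʳ KL MN k))))
           (*-mono-≤-nonNeg (ℚ.0≤∣p∣ (seq x m ℚ.- seq x n)) (ℚ.<⇒≤ C>0) (c n (⊔≤ʳ K L (⊔≤ˡ KL MN k)))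
             (d m n (⊔≤ˡ M N (⊔≤ʳ KL MN h)) (⊔≤ˡ M N (⊔≤ʳ KL MN k)))) ⟩
    B ℚ.* δy ℚ.+ C ℚ.* δx
      ≡⟨ cong₂ ℚ._+_ (cancel B B>0 ε) (cancel C C>0 ε) ⟩
    ½ ℚ.* ε ℚ.+ ½ ℚ.* ε
      ≡⟨ ½+½ ε ⟩
    ε ∎
  where
  open ℚ.≤-Reasoning
  open +-*-Solver
  cancel : ∀ B B>0 ε → B ℚ.* (inv B B>0 ℚ.* (½ ℚ.* ε)) ≡ ½ ℚ.* ε
  cancel B B>0 ε = trans (sym (ℚ.*-assoc B (inv B B>0) (½ ℚ.* ε)))
    (trans (cong (ℚ._* (½ ℚ.* ε)) (*-inv B B>0)) (ℚ.*-identityˡ (½ ℚ.* ε)))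

-- 1 / x for x > 0.  The witness of 0 < x contains δ > 0 with δ ≤ xₙ for all
-- large n, so that max(δ, xₙ) is nonzero for all n and equal to xₙ eventually.
1/⟨_,_⟩ : (x : ℝ) → 0ℝ < x → ℝ
1/⟨ x , (δ , δ>0 , _) ⟩ = mkℝ (λ n → inv (a n) (a>0 n)) λ ε ε>0 →
  let N , c = cauchy x (δ ℚ.* δ ℚ.* ε) (*-pos (*-pos δ>0 δ>0) ε>0)
  in N , λ m n h k → ∣-∣-≤ (half ε (ℚ.<⇒≤ ε>0) m n (c n m k h)) (half ε (ℚ.<⇒≤ ε>0) n m (c m n h k))
  where
  open ℚ.≤-Reasoning
  open +-*-Solver
  a : ℕ → ℚ
  a n = δ ℚ.⊔ seq x n
  a>0 : ∀ n → 0ℚ ℚ.< a n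
  a>0 n = ℚ.<-≤-trans δ>0 (ℚ.p≤p⊔q δ (seq x n))
  p≤q+∣p-q∣ : ∀ p q → p ℚ.≤ q ℚ.+ ∣ p ℚ.- q ∣
  p≤q+∣p-q∣ p q with ℚ.≤-total 0ℚ (p ℚ.- q)
  ... | inj₁ h = ℚ.≤-reflexive (trans (solve 2 (λ p q → p := q :+ (p :- q)) refl p q)
                                      (cong (q ℚ.+_) (sym (ℚ.0≤p⇒∣p∣≡p h))))
  ... | inj₂ h = begin
    p                       ≡⟨ solve 2 (λ p q → p := q :+ (p :- q)) refl p q ⟩
    q ℚ.+ (p ℚ.- q)         ≤⟨ ℚ.+-monoʳ-≤ q (ℚ.≤-trans h (ℚ.0≤∣p∣ (p ℚ.- q))) ⟩
    q ℚ.+ ∣ p ℚ.- q ∣       ∎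
  a-close : ∀ {e} → 0ℚ ℚ.≤ e → ∀ m n → ∣ seq x n ℚ.- seq x m ∣ ℚ.≤ e → a n ℚ.≤ a m ℚ.+ e
  a-close {e} e≥0 m n h = ℚ.⊔-lub
    (subst (ℚ._≤ a m ℚ.+ e) (ℚ.+-identityʳ δ) (ℚ.+-mono-≤ (ℚ.p≤p⊔q δ (seq x m)) e≥0))
    (ℚ.≤-trans (p≤q+∣p-q∣ (seq x n) (seq x m)) (ℚ.+-mono-≤ (ℚ.p≤q⊔p δ (seq x m)) h))
  half : ∀ ε → 0ℚ ℚ.≤ ε → ∀ m n → ∣ seq x n ℚ.- seq x m ∣ ℚ.≤ δ ℚ.* δ ℚ.* ε →
         inv (a m) (a>0 m) ℚ.≤ inv (a n) (a>0 n) ℚ.+ ε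
  half ε ε≥0 m n h = begin
    u                                     ≡⟨ sym (trans (cong (u ℚ.*_) (*-inv (a n) (a>0 n))) (ℚ.*-identityʳ u)) ⟩
    u ℚ.* (a n ℚ.* v)                     ≡⟨ solve 3 (λ u a v → u :* (a :* v) := (u :* v) :* a) refl u (a n) v ⟩
    (u ℚ.* v) ℚ.* a n                     ≤⟨ ℚ.*-monoˡ-≤-nonNeg (u ℚ.* v) {{ℚ.nonNegative uv≥0}} an≤ ⟩
    (u ℚ.* v) ℚ.* (a m ℚ.+ a m ℚ.* a n ℚ.* ε)
      ≡⟨ solve 5 (λ u v a b e → (u :* v) :* (a :+ a :* b :* e)
                              := (a :* u) :* v :+ (a :* u) :* (b :* v) :* e) refl u v (a m) (a n) ε ⟩
    (a m ℚ.* u) ℚ.* v ℚ.+ (a m ℚ.* u) ℚ.* (a n ℚ.* v) ℚ.* ε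
      ≡⟨ cong₂ (λ p q → p ℚ.* v ℚ.+ p ℚ.* q ℚ.* ε) (*-inv (a m) (a>0 m)) (*-inv (a n) (a>0 n)) ⟩
    1ℚ ℚ.* v ℚ.+ 1ℚ ℚ.* 1ℚ ℚ.* ε           ≡⟨ cong₂ ℚ._+_ (ℚ.*-identityˡ v) (ℚ.*-identityˡ ε) ⟩
    v ℚ.+ ε                               ∎
    where
    u = inv (a m) (a>0 m)
    v = inv (a n) (a>0 n)
    uv≥0 : 0ℚ ℚ.≤ u ℚ.* v
    uv≥0 = ℚ.<⇒≤ (*-pos (inv>0 (a m) (a>0 m)) (inv>0 (a n) (a>0 n)))
    δδ≤ : δ ℚ.* δ ℚ.≤ a m ℚ.* a n
    δδ≤ = *-mono-≤-nonNeg (ℚ.<⇒≤ δ>0) (ℚ.<⇒≤ (a>0 m)) (ℚ.p≤p⊔q δ (seq x m)) (ℚ.p≤p⊔q δ (seq x n))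
    an≤ : a n ℚ.≤ a m ℚ.+ a m ℚ.* a n ℚ.* ε
    an≤ = a-close (ℚ.≤-trans (ℚ.0≤∣p∣ (seq x n ℚ.- seq x m)) h′) m n h′
      where h′ = ℚ.≤-trans h (ℚ.*-monoʳ-≤-nonNeg ε {{ℚ.nonNegative ε≥0}} δδ≤)

-- the integer part of √ n
isqrt : ℕ → ℕ
isqrt zero = 0
isqrt (suc n) with suc (isqrt n) ℕ.* suc (isqrt n) ℕ.≤? suc n
... | yes _ = suc (isqrt n)
... | no  _ = isqrt n

isqrt-lower : ∀ n → isqrt n ℕ.* isqrt n ℕ.≤ n
isqrt-lower zero = ℕ.z≤n
isqrt-lower (suc n) with suc (isqrt n) ℕ.* suc (isqrt n) ℕ.≤? suc n
... | yes h = h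
... | no  _ = ℕ.m≤n⇒m≤1+n (isqrt-lower n)

isqrt-upper : ∀ n → n ℕ.< suc (isqrt n) ℕ.* suc (isqrt n)
isqrt-upper zero = ℕ.s≤s ℕ.z≤n
isqrt-upper (suc n) with suc (isqrt n) ℕ.* suc (isqrt n) ℕ.≤? suc n
... | yes _ = ℕ.<-≤-trans (ℕ.s≤s (isqrt-upper n))
                (ℕ.*-mono-< (ℕ.n<1+n (suc (isqrt n))) (ℕ.n<1+n (suc (isqrt n))))
... | no  h = ℕ.≰⇒> h

-- √ a is the limit of ⌊(n+1)√a⌋ / (n+1).
√_ : ℕ → ℝ
√ a = mkℝ s λ ε ε>0 →
  let N , c = archimedean ε ε>0
  in N , λ m n h k → ∣-∣-≤ (ℚ.≤-trans (close m n) (ℚ.+-monoʳ-≤ (s n) (c n k)))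
                            (ℚ.≤-trans (close n m) (ℚ.+-monoʳ-≤ (s m) (c m h)))
  where
  k : ℕ → ℕ
  k n = isqrt (a ℕ.* (suc n ℕ.* suc n))
  s : ℕ → ℚ
  s n = ℤ.+ k n ℚ./ suc n
  frac-≤ : ∀ {p q m n} → p ℕ.* suc n ℕ.≤ q ℕ.* suc m → ℤ.+ p ℚ./ suc m ℚ.≤ ℤ.+ q ℚ./ suc n
  frac-≤ {p} {q} {m} {n} h = ℚ.toℚᵘ-cancel-≤
    (ℚᵘ.≤-respˡ-≃ (ℚᵘ.≃-sym (ℚ.toℚᵘ-fromℚᵘ (ℚᵘ.mkℚᵘ (ℤ.+ p) m)))
    (ℚᵘ.≤-respʳ-≃ (ℚᵘ.≃-sym (ℚ.toℚᵘ-fromℚᵘ (ℚᵘ.mkℚᵘ (ℤ.+ q) n)))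
      (ℚᵘ.*≤* (subst₂ ℤ._≤_ (ℤ.pos-* p (suc n)) (ℤ.pos-* q (suc m)) (ℤ.+≤+ h)))))
  archimedean : ∀ ε → 0ℚ ℚ.< ε → Eventually (λ n → ℤ.+ 1 ℚ./ suc n ℚ.≤ ε)
  archimedean ε@(mkℚ (ℤ.+ suc p) d _) _ = d , λ n d≤n →
    subst (ℤ.+ 1 ℚ./ suc n ℚ.≤_) (ℚ.fromℚᵘ-toℚᵘ ε)
      (frac-≤ {1} {suc p} {n} {d} (ℕ.*-mono-≤ {1} {suc p} (ℕ.s≤s ℕ.z≤n) (ℕ.s≤s d≤n)))
  archimedean (mkℚ (ℤ.+ zero) _ _) (ℚ.*<* (ℤ.+<+ ()))
  archimedean (mkℚ ℤ.-[1+ _ ] _ _) (ℚ.*<* ())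
  square-cancel : ∀ p q → p ℕ.* p ℕ.≤ q ℕ.* q → p ℕ.≤ q
  square-cancel p q h = ℕ.≮⇒≥ λ q<p → ℕ.<⇒≱ (ℕ.*-mono-< q<p q<p) h
  cross : ∀ m n → k m ℕ.* suc n ℕ.≤ suc (k n) ℕ.* suc m
  cross m n = square-cancel _ _ (begin
    (k m ℕ.* suc n) ℕ.* (k m ℕ.* suc n)              ≡⟨ ℕ.[m*n]*[o*p]≡[m*o]*[n*p] (k m) (suc n) (k m) (suc n) ⟩
    (k m ℕ.* k m) ℕ.* (suc n ℕ.* suc n)              ≤⟨ ℕ.*-monoˡ-≤ (suc n ℕ.* suc n) (isqrt-lower (a ℕ.* (suc m ℕ.* suc m))) ⟩
    (a ℕ.* (suc m ℕ.* suc m)) ℕ.* (suc n ℕ.* suc n)  ≡⟨ swap a (suc m ℕ.* suc m) (suc n ℕ.* suc n) ⟩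
    (a ℕ.* (suc n ℕ.* suc n)) ℕ.* (suc m ℕ.* suc m)  ≤⟨ ℕ.*-monoˡ-≤ (suc m ℕ.* suc m) (ℕ.<⇒≤ (isqrt-upper (a ℕ.* (suc n ℕ.* suc n)))) ⟩
    (suc (k n) ℕ.* suc (k n)) ℕ.* (suc m ℕ.* suc m)  ≡⟨ ℕ.[m*n]*[o*p]≡[m*o]*[n*p] (suc (k n)) (suc (k n)) (suc m) (suc m) ⟩
    (suc (k n) ℕ.* suc m) ℕ.* (suc (k n) ℕ.* suc m)  ∎)
    where
    open ℕ.≤-Reasoning
    swap : ∀ x y z → (x ℕ.* y) ℕ.* z ≡ (x ℕ.* z) ℕ.* y
    swap = ℕSolver.solve-∀
  frac-+1 : ∀ p n → ℤ.+ suc p ℚ./ suc n ≡ ℤ.+ p ℚ./ suc n ℚ.+ ℤ.+ 1 ℚ./ suc n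
  frac-+1 p n = ℚ.toℚᵘ-injective (ℚᵘ.≃-trans (ℚ.toℚᵘ-fromℚᵘ (ℚᵘ.mkℚᵘ (ℤ.+ suc p) n))
    (ℚᵘ.≃-trans (ℚᵘ.*≡* eq) (ℚᵘ.≃-sym (ℚᵘ.≃-trans
      (ℚ.toℚᵘ-homo-+ (ℤ.+ p ℚ./ suc n) (ℤ.+ 1 ℚ./ suc n))
      (ℚᵘ.+-cong (ℚ.toℚᵘ-fromℚᵘ (ℚᵘ.mkℚᵘ (ℤ.+ p) n)) (ℚ.toℚᵘ-fromℚᵘ (ℚᵘ.mkℚᵘ (ℤ.+ 1) n)))))))
    where
    N = ℤ.+ suc n
    eq : ℤ.+ suc p ℤ.* (N ℤ.* N) ≡ (ℤ.+ p ℤ.* N ℤ.+ ℤ.+ 1 ℤ.* N) ℤ.* N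
    eq = trans (sym (ℤ.*-assoc (ℤ.+ suc p) N N)) (cong (ℤ._* N)
      (trans (cong (ℤ._* N) (cong ℤ.+_ (ℕ.+-comm 1 p))) (ℤ.*-distribʳ-+ N (ℤ.+ p) (ℤ.+ 1))))
  close : ∀ m n → s m ℚ.≤ s n ℚ.+ ℤ.+ 1 ℚ./ suc n
  close m n = subst (s m ℚ.≤_) (frac-+1 (k n) n) (frac-≤ {k m} {suc (k n)} {m} {n} (cross m n))

record Instance : Set₁ where
  field
    Item : Set
    _≟_  : DecidableEquality Item
    ν    : Item → ℝ
    ν≥0  : ∀ u → 0ℝ ≤ ν u

  -- (u , i) is the copy of the item u in the part Ωᵢ
  Ω : Set
  Ω = Item × ℕ

-- The elements of the sequence es at the positions in S.
select : ∀ {A : Set} {n} → Vec A n → Subset n → List A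
select []       []            = []
select (e ∷ es) (inside  ∷ S) = e ∷ select es S
select (e ∷ es) (outside ∷ S) = select es S

-- Sequences of arrived elements list the most recent arrival first; a set of
-- arrived elements is given by its positions in the sequence.
module _ (I : Instance) {n : ℕ} (es : Vec (Instance.Ω I) n) where
  open Instance I

  f : Subset n → ℝ
  f S = foldr (λ u x → ν u + x) 0ℝ (deduplicate _≟_ (map proj₁ (select es S)))

  Independent : Subset n → Set
  Independent S = ∀ i → length (filter (λ e → proj₂ e ℕ.≟ i) (select es S)) ℕ.≤ 1

  independent? : ∀ S → Dec (Independent S)
  independent? S = map′ to (λ ind → All.universal ind (map proj₂ l)) (All.all? (λ i → count i ℕ.≤? 1) (map proj₂ l))
    where
    l = select es S
    count : ℕ → ℕ
    count i = length (filter (λ e → proj₂ e ℕ.≟ i) l)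
    to : All (λ i → count i ℕ.≤ 1) (map proj₂ l) → Independent S
    to ok i with filter (λ e → proj₂ e ℕ.≟ i) l in eq
    ... | []    = ℕ.z≤n
    ... | e ∷ r with ∈-filter⁻ (λ e → proj₂ e ℕ.≟ i) (subst (e ∈_) (sym eq) (here refl))
    ...   | e∈l , refl = subst (λ r → length r ℕ.≤ 1) eq (All.lookup ok (∈-map⁺ proj₂ e∈l))

  IsOPT : Subset n → Set
  IsOPT T = Independent T × (∀ T′ → Independent T′ → f T′ ≤ f T)

-- The decision taken on an arrival, from the value and independence oracles on
-- the suc n elements arrived so far (position zero being the new one) and the
-- current set S ⊆ {earlier elements}: which elements to remove, and whether to
-- include the new one.  Items and parts are visible through the oracles only.
-- A strategy need not respect equality of reals: any function of the real values
-- is one, but so is one that inspects their rational approximations.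
Strategy : Set
Strategy = ∀ {n} (value : Subset (suc n) → ℝ) (indep : Subset (suc n) → Bool)
           (S : Subset n) → Subset n × Bool

run : Strategy → (I : Instance) → ∀ {n} → Vec (Instance.Ω I) n → Subset n
run σ I []           = []
run σ I es₁@(e ∷ es) =
  let S                = run σ I es
      removed , accept = σ (f I es₁) (λ T → does (independent? I es₁ T)) S
  in accept ∷ (S ─ removed)

record Algorithm : Set₁ where
  field
    strategy    : Strategy
    independent : ∀ I {n} (es : Vec (Instance.Ω I) n) → Unique es →
                  Independent I es (run strategy I es)

HasCompetitiveRatio : Algorithm → ℝ → Set₁
HasCompetitiveRatio A r =
  ∀ I {n} (es : Vec (Instance.Ω I) n) → Unique es →
  ∀ T → IsOPT I es T → r * f I es T ≤ f I es (run (Algorithm.strategy A) I es)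

{-# OPTIONS --safe #-}

-- An adaptive adversary beats every ratio above 1 / α, where α = 1 + β is
-- rational and β² < β + 1.  In part 0 it offers a chain of items of growing
-- weight.  While the algorithm holds the chain item c of weight z, the adversary
-- offers a second item of weight z in part 0, so that part 0 has a lost item of
-- weight z, then a filler of weight a in a fresh part, and c itself in that part.
-- The algorithm may not give up the filler, so c lies in that part without being
-- held there.  Hence when the next chain item of weight z′ replaces c in part 0,
-- which the algorithm may not refuse, c becomes an item that is lost to the
-- algorithm but still has a part to itself in an optimal solution.
--
-- With S the total of the fillers and P that of the lost chain items, the two
-- threats are effective for a = β (z + S) - (P + z) and z′ = β (z + S + a) - P.
-- Then z - α S is constant, and the fillers satisfy a″ = (1 + αβ) a′ - α² a.
-- The characteristic polynomial has no real root since 1 + αβ < 2α, which is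
-- β² < β + 1, so eventually a ≤ 0 and the algorithm has lost without a filler.
module Submission where

open import Defs
import Data.Rational.Base
open import Algebra.Definitions.RawMonoid Data.Rational.Base.+-0-rawMonoid using () renaming (_×_ to _⋆_)
open import Data.Bool using (Bool; true; false)
open import Data.Empty using (⊥; ⊥-elim)
open import Data.Fin.Subset using (Subset; inside; outside; _─_)
open import Data.Fin.Subset.Properties using (anySubset?)
import Data.Integer as ℤ
import Data.Integer.Properties as ℤ
open import Data.List using (List; []; _∷_; _++_; map; foldr; deduplicate; length)
import Data.List.Membership.DecPropositional as DecMembership
open import Data.List.Membership.Propositional using (_∈_; _∉_)
open import Data.List.Membership.Propositional.Properties using (∈-map⁺; ∈-map⁻; ∈-filter⁺; ∈-filter⁻; ∈-∃++; ∈-deduplicate⁺; ∈-deduplicate⁻; ∈-++⁺ˡ; ∈-++⁺ʳ; ∈-++⁻)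
open import Data.List.Relation.Binary.Permutation.Propositional using (_↭_; ↭-sym; ↭-prep; ↭⇒↭ₛ)
open import Data.List.Relation.Binary.Permutation.Propositional.Properties using (shift)
open import Data.List.Relation.Binary.Permutation.Setoid.Properties using (Unique-resp-↭)
open import Data.List.Relation.Binary.Subset.Propositional using (_⊆_)
open import Data.List.Relation.Unary.All as All using (All; []; _∷_)
import Data.List.Relation.Unary.All.Properties as All
open import Data.List.Relation.Unary.AllPairs using ([]; _∷_)
open import Data.List.Relation.Unary.Any using (here; there)
open import Data.List.Relation.Unary.Unique.DecPropositional.Properties using (deduplicate-!)
open import Data.List.Relation.Unary.Unique.Propositional using (Unique)
import Data.List.Relation.Unary.Unique.Propositional.Properties as Unique
open import Data.Nat as ℕ using (ℕ; zero; suc)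
import Data.Nat.Properties as ℕ
open import Data.Product using (∃-syntax; _×_; _,_; proj₁; proj₂)
open import Data.Product.Properties using (≡-dec)
open import Data.Rational as ℚ using (ℚ; 0ℚ; 1ℚ; ½; ∣_∣)
import Data.Rational.Properties as ℚ
open import Data.Rational.Solver using (module +-*-Solver)
import Data.Rational.Unnormalised as ℚᵘ
import Data.Rational.Unnormalised.Properties as ℚᵘ
open import Data.Sum using (_⊎_; inj₁; inj₂; map₂)
open import Data.Vec as Vec using (Vec; []; _∷_)
import Data.Vec.Membership.Propositional as Vec
open import Data.Vec.Relation.Unary.All as VecAll using ([]; _∷_)
open import Data.Vec.Relation.Unary.AllPairs using ([]; _∷_)
open import Data.Vec.Relation.Unary.Any using (here; there)
open import Data.Vec.Relation.Unary.Unique.Propositional using () renaming (Unique to Distinct)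
open import Function using (_∘_; id)
open import Level using (0ℓ)
open import Relation.Binary.PropositionalEquality
open import Relation.Binary.PropositionalEquality.Properties using (setoid)
open import Relation.Nullary using (Dec; does; yes; no; ¬_)
open import Relation.Unary using (Pred; Decidable)

-- Repetition-free lists and sets of positions.

private
  variable
    X Y : Set
    n : ℕ
    x y : X
    xs ys : List X

unique-≤1 : Unique xs → (∀ {x y} → x ∈ xs → y ∈ xs → x ≡ y) → length xs ℕ.≤ 1
unique-≤1 {xs = []}         _               _  = ℕ.z≤n
unique-≤1 {xs = _ ∷ []}     _               _  = ℕ.s≤s ℕ.z≤n
unique-≤1 {xs = _ ∷ _ ∷ _} ((x≢y ∷ _) ∷ _) eq =
  ⊥-elim (x≢y (eq (here refl) (there (here refl))))

≤1-equal : length xs ℕ.≤ 1 → x ∈ xs → y ∈ xs → x ≡ y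
≤1-equal {xs = _ ∷ []}     _                (here refl) (here refl) = refl
≤1-equal {xs = _ ∷ _ ∷ _} (ℕ.s≤s ())

unique-map-injective : (g : X → Y) → Unique (map g xs) → x ∈ xs → y ∈ xs → g x ≡ g y → x ≡ y
unique-map-injective g _          (here refl) (here refl) _  = refl
unique-map-injective g (g≢ ∷ _)   (here refl) (there y∈)  eq = ⊥-elim (All.lookup g≢ (∈-map⁺ g y∈) eq)
unique-map-injective g (g≢ ∷ _)   (there x∈)  (here refl) eq = ⊥-elim (All.lookup g≢ (∈-map⁺ g x∈) (sym eq))
unique-map-injective g (_ ∷ uniq) (there x∈)  (there y∈)  eq = unique-map-injective g uniq x∈ y∈ eq

unique-∷⁺ : x ∉ xs → Unique xs → Unique (x ∷ xs)
unique-∷⁺ x∉ uniq = All.tabulate (λ y∈ x≡y → x∉ (subst (_∈ _) (sym x≡y) y∈)) ∷ uniq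

lookup : ∀ {es : Vec X n} {P : Pred X 0ℓ} → VecAll.All P es → x Vec.∈ es → P x
lookup (p ∷ _)  (here refl) = p
lookup (_ ∷ ps) (there x∈)  = lookup ps x∈

∈-select⁻ : ∀ {es : Vec X n} S → x ∈ select es S → x Vec.∈ es
∈-select⁻ {es = []}    []            ()
∈-select⁻ {es = _ ∷ _} (inside  ∷ S) (here refl) = here refl
∈-select⁻ {es = _ ∷ _} (inside  ∷ S) (there x∈)  = there (∈-select⁻ S x∈)
∈-select⁻ {es = _ ∷ _} (outside ∷ S) x∈          = there (∈-select⁻ S x∈)

select-unique : ∀ {es : Vec X n} S → Distinct es → Unique (select es S)
select-unique {es = []}    []            _           = []
select-unique {es = _ ∷ _} (inside ∷ S)  (e≢ ∷ uniq) =
  unique-∷⁺ (λ e∈ → lookup e≢ (∈-select⁻ S e∈) refl) (select-unique S uniq)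
select-unique {es = _ ∷ _} (outside ∷ S) (_ ∷ uniq)  = select-unique S uniq

select-─ : ∀ (es : Vec X n) S R → select es (S ─ R) ⊆ select es S
select-─ []       []            []            ()
select-─ (e ∷ es) (inside  ∷ S) (inside  ∷ R) x∈          = there (select-─ es S R x∈)
select-─ (e ∷ es) (inside  ∷ S) (outside ∷ R) (here refl) = here refl
select-─ (e ∷ es) (inside  ∷ S) (outside ∷ R) (there x∈)  = there (select-─ es S R x∈)
select-─ (e ∷ es) (outside ∷ S) (inside  ∷ R) x∈          = select-─ es S R x∈
select-─ (e ∷ es) (outside ∷ S) (outside ∷ R) x∈          = select-─ es S R x∈

positions : {P : Pred X 0ℓ} → Decidable P → Vec X n → Subset n
positions P? = Vec.map (λ e → does (P? e))

∈-select-positions⁻ : {P : Pred X 0ℓ} (P? : Decidable P) (es : Vec X n) → x ∈ select es (positions P? es) → P x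
∈-select-positions⁻ P? (e ∷ es) x∈ with P? e
∈-select-positions⁻ P? (e ∷ es) (here refl) | yes Pe = Pe
∈-select-positions⁻ P? (e ∷ es) (there x∈)  | yes _  = ∈-select-positions⁻ P? es x∈
∈-select-positions⁻ P? (e ∷ es) x∈          | no  _  = ∈-select-positions⁻ P? es x∈

∈-select-positions⁺ : {P : Pred X 0ℓ} (P? : Decidable P) {es : Vec X n} → x Vec.∈ es → P x → x ∈ select es (positions P? es)
∈-select-positions⁺ P? {e ∷ es} (here refl) Px with P? e
... | yes _  = here refl
... | no ¬Px = ⊥-elim (¬Px Px)
∈-select-positions⁺ P? {e ∷ es} (there x∈)  Px with P? e
... | yes _ = there (∈-select-positions⁺ P? x∈ Px)
... | no  _ = ∈-select-positions⁺ P? x∈ Px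

-- The sets with and without the first position are searched separately; `anySubset?` decides
-- whether a branch has a candidate at all, so only nonempty branches supply a maximiser.
maximum : {P : Pred (Subset n) 0ℓ} → Decidable P → (g : Subset n → ℚ) → ∃[ S ] P S →
          ∃[ T ] P T × (∀ S → P S → g S ℚ.≤ g T)
maximum {zero}  P? g ([] , P[]) = [] , P[] , λ { [] _ → ℚ.≤-refl }
maximum {suc n} {P} P? g (S , PS) with any? inside | any? outside
  where
  any? : ∀ b → (∃[ T ] P (b ∷ T) × (∀ S → P (b ∷ S) → g (b ∷ S) ℚ.≤ g (b ∷ T))) ⊎ (∀ S → ¬ P (b ∷ S))
  any? b with anySubset? (λ S → P? (b ∷ S))
  ... | yes w = inj₁ (maximum (λ S → P? (b ∷ S)) (λ S → g (b ∷ S)) w)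
  ... | no ¬w = inj₂ λ S PS → ¬w (S , PS)
maximum P? g (inside  ∷ S , PS) | inj₂ none | _ = ⊥-elim (none S PS)
maximum P? g (outside ∷ S , PS) | _ | inj₂ none = ⊥-elim (none S PS)
... | inj₁ (T , PT , ub) | inj₂ none =
  inside ∷ T , PT , λ { (inside ∷ S) → ub S ; (outside ∷ S) PS → ⊥-elim (none S PS) }
... | inj₂ none | inj₁ (T , PT , ub) =
  outside ∷ T , PT , λ { (outside ∷ S) → ub S ; (inside ∷ S) PS → ⊥-elim (none S PS) }
... | inj₁ (T , PT , ub) | inj₁ (T′ , PT′ , ub′) with ℚ.≤-total (g (inside ∷ T)) (g (outside ∷ T′))
...   | inj₁ T≤T′ = outside ∷ T′ , PT′ , λ { (inside ∷ S) PS → ℚ.≤-trans (ub S PS) T≤T′ ; (outside ∷ S) → ub′ S }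
...   | inj₂ T′≤T = inside ∷ T , PT , λ { (inside ∷ S) → ub S ; (outside ∷ S) PS → ℚ.≤-trans (ub′ S PS) T′≤T }

-- The adversary chooses its items adaptively: an item is a weight together with
-- a label that makes it fresh.
Item : Set
Item = ℚ × ℕ

weight : Item → ℚ
weight (q , _) = ∣ q ∣

I : Instance
I = record
  { Item = Item
  ; _≟_  = ≡-dec ℚ._≟_ ℕ._≟_
  ; ν    = λ u → fromℚ (weight u)
  ; ν≥0  = λ { (q , _) ε ε>0 → 0 , λ _ _ → ℚ.+-mono-≤ (ℚ.0≤∣p∣ q) (ℚ.<⇒≤ ε>0) }
  }

open Instance I using (Ω; _≟_)

-- Values of `f` as rational totals.

total : List Item → ℚ
total = foldr (λ u → weight u ℚ.+_) 0ℚ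

value : ∀ (es : Vec Ω n) → Subset n → ℚ
value es S = total (deduplicate _≟_ (map proj₁ (select es S)))

-- All weights of `I` are constant Cauchy sequences, so comparisons of real values of `f` reduce to
-- rational arithmetic.
seq-f : ∀ (es : Vec Ω n) S k → seq (f I es S) k ≡ value es S
seq-f es S k = go (deduplicate _≟_ (map proj₁ (select es S)))
  where
  go : ∀ us → seq (foldr (λ u x → Instance.ν I u + x) 0ℝ us) k ≡ total us
  go []       = refl
  go (u ∷ us) = cong (weight u ℚ.+_) (go us)

f-mono : ∀ (es : Vec Ω n) S T → value es S ℚ.≤ value es T → f I es S ≤ f I es T
f-mono es S T S≤T ε ε>0 = 0 , λ k _ → subst₂ (λ a b → a ℚ.≤ b ℚ.+ ε)
  (sym (seq-f es S k)) (sym (seq-f es T k))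
  (ℚ.≤-trans S≤T (subst (ℚ._≤ value es T ℚ.+ ε) (ℚ.+-identityʳ _) (ℚ.+-monoʳ-≤ (value es T) (ℚ.<⇒≤ ε>0))))

total-insert : ∀ us {u vs} → total (us ++ u ∷ vs) ≡ weight u ℚ.+ total (us ++ vs)
total-insert []               = refl
total-insert (v ∷ us) {u} {vs} = trans (cong (weight v ℚ.+_) (total-insert us))
  (solve 3 (λ v u t → v :+ (u :+ t) := u :+ (v :+ t)) refl (weight v) (weight u) (total (us ++ vs)))
  where open +-*-Solver

total≥0 : ∀ us → 0ℚ ℚ.≤ total us
total≥0 []             = ℚ.≤-refl
total≥0 ((q , _) ∷ us) = ℚ.+-mono-≤ (ℚ.0≤∣p∣ q) (total≥0 us)

-- Cut one occurrence of `u` out of `vs`: the rest of `us` avoids `u`, so it still lies in what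
-- remains.
total-mono : ∀ {us vs} → Unique us → us ⊆ vs → total us ℚ.≤ total vs
total-mono {[]}     {vs} _           _   = total≥0 vs
total-mono {u ∷ us}      (u≢ ∷ uniq) sub with ∈-∃++ (sub (here refl))
... | as , bs , refl = subst (weight u ℚ.+ total us ℚ.≤_) (sym (total-insert as))
  (ℚ.+-monoʳ-≤ (weight u) (total-mono uniq sub′))
  where
  sub′ : us ⊆ as ++ bs
  sub′ v∈ with ∈-++⁻ as (sub (there v∈))
  ... | inj₁ v∈as         = ∈-++⁺ˡ v∈as
  ... | inj₂ (here refl)  = ⊥-elim (All.lookup u≢ v∈ refl)
  ... | inj₂ (there v∈bs) = ∈-++⁺ʳ as v∈bs

-- Copies of an item in several parts count once, so a list covering the held items bounds the value
-- however many copies are held.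
value≤total : ∀ {H} (es : Vec Ω n) S → map proj₁ (select es S) ⊆ H → value es S ℚ.≤ total H
value≤total es S sub = total-mono (deduplicate-! _≟_ _) (sub ∘ ∈-deduplicate⁻ _≟_ (map proj₁ (select es S)))

total≤value : ∀ {H} (es : Vec Ω n) S → Unique H → H ⊆ map proj₁ (select es S) → total H ℚ.≤ value es S
total≤value es S uniq sub = total-mono uniq (∈-deduplicate⁺ _≟_ ∘ sub)

-- Independence and optimal solutions.

select-independent : ∀ {es : Vec Ω n} S → Distinct es →
  (∀ {x y} → x ∈ select es S → y ∈ select es S → proj₂ x ≡ proj₂ y → x ≡ y) → Independent I es S
select-independent {es = es} S uniq inj i = unique-≤1 (Unique.filter⁺ i? (select-unique S uniq)) λ x∈ y∈ →
  let x∈S , x≡i = ∈-filter⁻ i? {xs = select es S} x∈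
      y∈S , y≡i = ∈-filter⁻ i? {xs = select es S} y∈
  in inj x∈S y∈S (trans x≡i (sym y≡i))
  where
  i? : Decidable (λ (e : Ω) → proj₂ e ≡ i)
  i? e = proj₂ e ℕ.≟ i

independent-injective : ∀ {es : Vec Ω n} S → Independent I es S →
  ∀ {x y} → x ∈ select es S → y ∈ select es S → proj₂ x ≡ proj₂ y → x ≡ y
independent-injective S ind {x} x∈ y∈ eq = ≤1-equal (ind (proj₂ x))
  (∈-filter⁺ (λ e → proj₂ e ℕ.≟ proj₂ x) x∈ refl)
  (∈-filter⁺ (λ e → proj₂ e ℕ.≟ proj₂ x) y∈ (sym eq))

-- `W` is a feasible solution: arrived elements with distinct items in distinct parts. An optimum
-- exists by finite search and is worth at least as much, so exhibiting `W` is enough to bound it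
-- from below.
opt-exists : ∀ {es : Vec Ω n} → Distinct es → ∀ W →
  All (Vec._∈ es) W → Unique (map proj₂ W) → Unique (map proj₁ W) →
  ∃[ T ] IsOPT I es T × total (map proj₁ W) ℚ.≤ value es T
opt-exists {n = n} {es = es} uniq W arrived parts items =
  let T , indT , ub = maximum (independent? I es) (value es) (S , ind)
  in T , (indT , λ T′ ind′ → f-mono es T′ T (ub T′ ind′)) , ℚ.≤-trans (total≤value es S items sub) (ub S ind)
  where
  open DecMembership (≡-dec _≟_ ℕ._≟_) using (_∈?_)
  S : Subset n
  S = positions (_∈? W) es
  ind : Independent I es S
  ind = select-independent S uniq λ x∈ y∈ → unique-map-injective proj₂ parts
    (∈-select-positions⁻ (_∈? W) es x∈) (∈-select-positions⁻ (_∈? W) es y∈)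
  sub : map proj₁ W ⊆ map proj₁ (select es S)
  sub u∈ with ∈-map⁻ proj₁ u∈
  ... | e , e∈ , refl = ∈-map⁺ proj₁ (∈-select-positions⁺ (_∈? W) (All.lookup arrived e∈) e∈)

-- Rational inequalities and the Archimedean property.

p≤q⇒p-q≤0 : ∀ {p q} → p ℚ.≤ q → p ℚ.- q ℚ.≤ 0ℚ
p≤q⇒p-q≤0 {p} {q} p≤q = subst (p ℚ.- q ℚ.≤_) (ℚ.+-inverseʳ q) (ℚ.+-monoˡ-≤ (ℚ.- q) p≤q)

p≤q⇒0≤q-p : ∀ {p q} → p ℚ.≤ q → 0ℚ ℚ.≤ q ℚ.- p
p≤q⇒0≤q-p {p} {q} p≤q = subst (ℚ._≤ q ℚ.- p) (ℚ.+-inverseʳ p) (ℚ.+-monoˡ-≤ (ℚ.- p) p≤q)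

p<q⇒0<q-p : ∀ {p q} → p ℚ.< q → 0ℚ ℚ.< q ℚ.- p
p<q⇒0<q-p {p} {q} p<q = subst (ℚ._< q ℚ.- p) (ℚ.+-inverseʳ p) (ℚ.+-monoˡ-< (ℚ.- p) p<q)

*-pos : ∀ {p q} → 0ℚ ℚ.< p → 0ℚ ℚ.< q → 0ℚ ℚ.< p ℚ.* q
*-pos {p} {q} p>0 q>0 = ℚ.positive⁻¹ (p ℚ.* q) {{ℚ.pos*pos⇒pos p {{ℚ.positive p>0}} q {{ℚ.positive q>0}}}}

*-monoˡ : ∀ {r p q} → 0ℚ ℚ.≤ r → p ℚ.≤ q → r ℚ.* p ℚ.≤ r ℚ.* q
*-monoˡ {r} r≥0 = ℚ.*-monoˡ-≤-nonNeg r {{ℚ.nonNegative r≥0}}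

*-monoʳ : ∀ {r p q} → 0ℚ ℚ.≤ r → p ℚ.≤ q → p ℚ.* r ℚ.≤ q ℚ.* r
*-monoʳ {r} r≥0 = ℚ.*-monoʳ-≤-nonNeg r {{ℚ.nonNegative r≥0}}

square≥0 : ∀ p → 0ℚ ℚ.≤ p ℚ.* p
square≥0 p with ℚ.≤-total 0ℚ p
... | inj₁ 0≤p = subst (ℚ._≤ p ℚ.* p) (ℚ.*-zeroʳ p) (*-monoˡ 0≤p 0≤p)
... | inj₂ p≤0 = subst (ℚ._≤ p ℚ.* p) (ℚ.*-zeroʳ p) (ℚ.*-monoˡ-≤-nonPos p {{ℚ.nonPositive p≤0}} p≤0)

⋆-* : ∀ k p → k ⋆ p ≡ k ⋆ 1ℚ ℚ.* p
⋆-* zero    p = sym (ℚ.*-zeroˡ p)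
⋆-* (suc k) p = trans (cong₂ ℚ._+_ (sym (ℚ.*-identityˡ p)) (⋆-* k p)) (sym (ℚ.*-distribʳ-+ p 1ℚ (k ⋆ 1ℚ)))

⋆-nonNeg : ∀ k {p} → 0ℚ ℚ.≤ p → 0ℚ ℚ.≤ k ⋆ p
⋆-nonNeg zero    _   = ℚ.≤-refl
⋆-nonNeg (suc k) 0≤p = ℚ.+-mono-≤ 0≤p (⋆-nonNeg k 0≤p)

toℚᵘ-⋆1 : ∀ k → ℚ.toℚᵘ (k ⋆ 1ℚ) ℚᵘ.≃ ℚᵘ.mkℚᵘ (ℤ.+ k) 0
toℚᵘ-⋆1 zero    = ℚᵘ.≃-refl
toℚᵘ-⋆1 (suc k) = ℚᵘ.≃-trans (ℚ.toℚᵘ-homo-+ 1ℚ (k ⋆ 1ℚ))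
  (ℚᵘ.≃-trans (ℚᵘ.+-congʳ ℚᵘ.1ℚᵘ (toℚᵘ-⋆1 k))
    (ℚᵘ.≃-reflexive (cong (λ i → ℚᵘ.mkℚᵘ i 0) (cong (λ i → ℤ.+ 1 ℤ.+ i) (ℤ.*-identityʳ (ℤ.+ k))))))

-- The denominator is at least 1, so dropping it and the sign of the numerator cannot decrease `p`.
≤∣↥p∣⋆1 : ∀ p → p ℚ.≤ ℤ.∣ ℚ.↥ p ∣ ⋆ 1ℚ
≤∣↥p∣⋆1 p@(ℚ.mkℚ i d _) = ℚ.toℚᵘ-cancel-≤ (ℚᵘ.≤-respʳ-≃ (ℚᵘ.≃-sym (toℚᵘ-⋆1 ℤ.∣ i ∣))
  (ℚᵘ.*≤* (ℤ.≤-trans (ℤ.≤-reflexive (ℤ.*-identityʳ i)) (bound i))))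
  where
  bound : ∀ i → i ℤ.≤ ℤ.+ ℤ.∣ i ∣ ℤ.* ℤ.+ suc d
  bound (ℤ.+ k)      = subst (ℤ.+ k ℤ.≤_) (ℤ.pos-* k (suc d)) (ℤ.+≤+ (ℕ.m≤m*n k (suc d)))
  bound ℤ.-[1+ k ]   = ℤ.-≤+

archimedean : ∀ p {q} → 0ℚ ℚ.< q → ∃[ k ] p ℚ.≤ k ⋆ q
archimedean p {q} 0<q = k , (begin
  p                     ≡⟨ ℚ.*-identityʳ p ⟨
  p ℚ.* 1ℚ              ≡⟨ cong (p ℚ.*_) (ℚ.*-inverseˡ q) ⟨
  p ℚ.* (ℚ.1/ q ℚ.* q)  ≡⟨ ℚ.*-assoc p (ℚ.1/ q) q ⟨
  p ℚ.* ℚ.1/ q ℚ.* q    ≤⟨ *-monoʳ (ℚ.<⇒≤ 0<q) (≤∣↥p∣⋆1 (p ℚ.* ℚ.1/ q)) ⟩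
  k ⋆ 1ℚ ℚ.* q          ≡⟨ ⋆-* k q ⟨
  k ⋆ q                 ∎)
  where
  open ℚ.≤-Reasoning
  instance _ = ℚ.>-nonZero 0<q
  k : ℕ
  k = ℤ.∣ ℚ.↥ (p ℚ.* ℚ.1/ q) ∣

-- Consecutive increments b, a, a′ = (1 + αβ) a - α² b satisfy
-- a′ b + (a - α b)² = a (a - δ b) with δ = β + 1 - β², so that a / b drops by δ.
increment-ratio : ∀ β {a b κ} → let α = 1ℚ ℚ.+ β; δ = β ℚ.+ 1ℚ ℚ.- β ℚ.* β in
  0ℚ ℚ.< b → 0ℚ ℚ.≤ a → a ℚ.≤ (δ ℚ.+ κ) ℚ.* b →
  (1ℚ ℚ.+ α ℚ.* β) ℚ.* a ℚ.- α ℚ.* α ℚ.* b ℚ.≤ κ ℚ.* a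
increment-ratio β {a} {b} {κ} 0<b 0≤a a≤ = ℚ.*-cancelʳ-≤-pos b {{ℚ.positive 0<b}} (begin
  a′ ℚ.* b                                           ≡⟨ ℚ.+-identityʳ (a′ ℚ.* b) ⟨
  a′ ℚ.* b ℚ.+ 0ℚ                                    ≤⟨ ℚ.+-monoʳ-≤ (a′ ℚ.* b) (square≥0 (a ℚ.- α ℚ.* b)) ⟩
  a′ ℚ.* b ℚ.+ (a ℚ.- α ℚ.* b) ℚ.* (a ℚ.- α ℚ.* b)   ≡⟨ complete-square β a b ⟩
  a ℚ.* (a ℚ.- δ ℚ.* b)                              ≤⟨ *-monoˡ 0≤a (ℚ.+-monoˡ-≤ (ℚ.- (δ ℚ.* b)) a≤) ⟩
  a ℚ.* ((δ ℚ.+ κ) ℚ.* b ℚ.- δ ℚ.* b)                ≡⟨ cancel a b δ κ ⟩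
  κ ℚ.* a ℚ.* b                                      ∎)
  where
  open ℚ.≤-Reasoning
  open +-*-Solver
  α δ a′ : ℚ
  α  = 1ℚ ℚ.+ β
  δ  = β ℚ.+ 1ℚ ℚ.- β ℚ.* β
  a′ = (1ℚ ℚ.+ α ℚ.* β) ℚ.* a ℚ.- α ℚ.* α ℚ.* b
  complete-square : ∀ β a b → let α = 1ℚ ℚ.+ β; δ = β ℚ.+ 1ℚ ℚ.- β ℚ.* β in
    ((1ℚ ℚ.+ α ℚ.* β) ℚ.* a ℚ.- α ℚ.* α ℚ.* b) ℚ.* b ℚ.+ (a ℚ.- α ℚ.* b) ℚ.* (a ℚ.- α ℚ.* b)
      ≡ a ℚ.* (a ℚ.- δ ℚ.* b)
  complete-square = solve 3 (λ β a b →
    let α = con 1ℚ :+ β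
        δ = β :+ con 1ℚ :- β :* β
    in ((con 1ℚ :+ α :* β) :* a :- α :* α :* b) :* b :+ (a :- α :* b) :* (a :- α :* b) := a :* (a :- δ :* b)) refl
  cancel : ∀ a b δ κ → a ℚ.* ((δ ℚ.+ κ) ℚ.* b ℚ.- δ ℚ.* b) ≡ κ ℚ.* a ℚ.* b
  cancel = solve 4 (λ a b δ κ → a :* ((δ :+ κ) :* b :- δ :* b) := κ :* a :* b) refl

-- Rational bounds extracted from the real hypotheses on `α` and `r`.

√-square : ∀ m k → seq (√ m) k ℚ.* seq (√ m) k ℚ.≤ ℤ.+ m ℚ./ 1
√-square m k = ℚ.toℚᵘ-cancel-≤
  (ℚᵘ.≤-respˡ-≃ (ℚᵘ.≃-sym (ℚᵘ.≃-trans (ℚ.toℚᵘ-homo-* s s) (ℚᵘ.*-cong s≃ s≃)))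
  (ℚᵘ.≤-respʳ-≃ (ℚᵘ.≃-sym (ℚ.toℚᵘ-fromℚᵘ (ℚᵘ.mkℚᵘ (ℤ.+ m) 0)))
  (ℚᵘ.*≤* (subst₂ ℤ._≤_
    (trans (ℤ.pos-* j j) (sym (ℤ.*-identityʳ (ℤ.+ j ℤ.* ℤ.+ j))))
    (ℤ.pos-* m (suc k ℕ.* suc k))
    -- The approximations of the root are rounded down, so the bound on the square holds at every
    -- index and not just in the limit.
    (ℤ.+≤+ (isqrt-lower (m ℕ.* (suc k ℕ.* suc k))))))))
  where
  j : ℕ
  j = isqrt (m ℕ.* (suc k ℕ.* suc k))
  s : ℚ
  s = seq (√ m) k
  s≃ : ℚ.toℚᵘ s ℚᵘ.≃ ℚᵘ.mkℚᵘ (ℤ.+ j) k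
  s≃ = ℚ.toℚᵘ-fromℚᵘ (ℚᵘ.mkℚᵘ (ℤ.+ j) k)

-- Completing the square gives `4 (β² - β - 1) = (2β - 1)² - 5`. Since `2β - 1` is positive,
-- squaring preserves `2β - 1 < s`.
below-golden : ∀ {β s} → 1ℚ ℚ.≤ β → β ℚ.+ β ℚ.- 1ℚ ℚ.< s → s ℚ.* s ℚ.≤ ℤ.+ 5 ℚ./ 1 → β ℚ.* β ℚ.< β ℚ.+ 1ℚ
below-golden {β} {s} 1≤β t<s s²≤5 = ℚ.*-cancelˡ-<-nonNeg four (begin-strict
  four ℚ.* (β ℚ.* β)                              ≡⟨ expand β ⟩
  t ℚ.* t ℚ.+ (four ℚ.* β ℚ.- 1ℚ)                 <⟨ ℚ.+-monoˡ-< (four ℚ.* β ℚ.- 1ℚ) t²<5 ⟩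
  ℤ.+ 5 ℚ./ 1 ℚ.+ (four ℚ.* β ℚ.- 1ℚ)             ≡⟨ collect β ⟩
  four ℚ.* (β ℚ.+ 1ℚ)                             ∎)
  where
  open ℚ.≤-Reasoning
  open +-*-Solver
  four t : ℚ
  four = ℤ.+ 4 ℚ./ 1
  t    = β ℚ.+ β ℚ.- 1ℚ
  expand : ∀ β → four ℚ.* (β ℚ.* β) ≡ (β ℚ.+ β ℚ.- 1ℚ) ℚ.* (β ℚ.+ β ℚ.- 1ℚ) ℚ.+ (four ℚ.* β ℚ.- 1ℚ)
  expand = solve 1 (λ β → con four :* (β :* β) :=
    (β :+ β :- con 1ℚ) :* (β :+ β :- con 1ℚ) :+ (con four :* β :- con 1ℚ)) refl
  collect : ∀ β → ℤ.+ 5 ℚ./ 1 ℚ.+ (four ℚ.* β ℚ.- 1ℚ) ≡ four ℚ.* (β ℚ.+ 1ℚ)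
  collect = solve 1 (λ β → con (ℤ.+ 5 ℚ./ 1) :+ (con four :* β :- con 1ℚ) := con four :* (β :+ con 1ℚ)) refl
  0<t : 0ℚ ℚ.< t
  0<t = ℚ.<-≤-trans (ℚ.positive⁻¹ 1ℚ) (ℚ.+-monoˡ-≤ (ℚ.- 1ℚ) (ℚ.+-mono-≤ 1≤β 1≤β))
  t²<5 : t ℚ.* t ℚ.< ℤ.+ 5 ℚ./ 1
  t²<5 = begin-strict
    t ℚ.* t  <⟨ ℚ.*-monoʳ-<-pos t {{ℚ.positive 0<t}} t<s ⟩
    t ℚ.* s  ≤⟨ *-monoʳ (ℚ.<⇒≤ (ℚ.<-trans 0<t t<s)) (ℚ.<⇒≤ t<s) ⟩
    s ℚ.* s  ≤⟨ s²≤5 ⟩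
    ℤ.+ 5 ℚ./ 1 ∎

p≤∣p∣ : ∀ p → p ℚ.≤ ∣ p ∣
p≤∣p∣ p with ℚ.≤-total 0ℚ p
... | inj₁ 0≤p = ℚ.≤-reflexive (sym (ℚ.0≤p⇒∣p∣≡p 0≤p))
... | inj₂ p≤0 = ℚ.≤-trans p≤0 (ℚ.0≤∣p∣ p)

-- For `y = √ 5` the bound on `α` is the square of the golden ratio φ, that is 1 + φ. Hence a
-- rational `1 + β` strictly between `α` and it has β < φ, which reads `β² < β + 1`.
rational-bound : ∀ α y → (∀ k → seq y k ℚ.* seq y k ℚ.≤ ℤ.+ 5 ℚ./ 1) → α < (fromℕ 3 + y) * fromℚ ½ →
  ∃[ β ] 1ℚ ℚ.≤ β × β ℚ.* β ℚ.< β ℚ.+ 1ℚ × Eventually (λ k → seq α k ℚ.≤ 1ℚ ℚ.+ β)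
rational-bound α y y²≤5 (ε , 0<ε , M , h) with cauchy α (½ ℚ.* ε) (*-pos (ℚ.positive⁻¹ ½) 0<ε)
... | N , c = choose
  where
  open ℚ.≤-Reasoning
  open +-*-Solver
  m : ℕ
  m = M ℕ.⊔ N
  α₀ s β : ℚ
  α₀ = seq α m
  s  = seq y m
  -- One half of the gap `ε` absorbs the oscillation of `α` beyond `N`; the other keeps `2β - 1`
  -- strictly below `s`.
  β  = α₀ ℚ.+ ½ ℚ.* ε ℚ.- 1ℚ
  hm : α₀ ℚ.+ ε ℚ.≤ (ℤ.+ 3 ℚ./ 1 ℚ.+ s) ℚ.* ½
  hm = h m (ℕ.m≤m⊔n M N)
  α≤ : ∀ k → N ℕ.≤ k → seq α k ℚ.≤ 1ℚ ℚ.+ β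
  α≤ k N≤k = begin
    seq α k                        ≡⟨ solve 2 (λ p q → p := q :+ (p :- q)) refl (seq α k) α₀ ⟩
    α₀ ℚ.+ (seq α k ℚ.- α₀)        ≤⟨ ℚ.+-monoʳ-≤ α₀ (p≤∣p∣ (seq α k ℚ.- α₀)) ⟩
    α₀ ℚ.+ ∣ seq α k ℚ.- α₀ ∣      ≤⟨ ℚ.+-monoʳ-≤ α₀ (c k m N≤k (ℕ.m≤n⊔m M N)) ⟩
    α₀ ℚ.+ ½ ℚ.* ε                 ≡⟨ solve 1 (λ y → y := con 1ℚ :+ (y :- con 1ℚ)) refl (α₀ ℚ.+ ½ ℚ.* ε) ⟩
    1ℚ ℚ.+ β                       ∎
  two : ℚ
  two = ℤ.+ 2 ℚ./ 1
  t<s : β ℚ.+ β ℚ.- 1ℚ ℚ.< s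
  t<s = begin-strict
    β ℚ.+ β ℚ.- 1ℚ                                 ≡⟨ ℚ.+-identityʳ _ ⟨
    β ℚ.+ β ℚ.- 1ℚ ℚ.+ 0ℚ                          <⟨ ℚ.+-monoʳ-< (β ℚ.+ β ℚ.- 1ℚ) 0<ε ⟩
    β ℚ.+ β ℚ.- 1ℚ ℚ.+ ε                           ≡⟨ double α₀ ε ⟩
    two ℚ.* (α₀ ℚ.+ ε) ℚ.- ℤ.+ 3 ℚ./ 1              ≤⟨ ℚ.+-monoˡ-≤ (ℚ.- (ℤ.+ 3 ℚ./ 1)) (*-monoˡ {two} (ℚ.nonNegative⁻¹ two) hm) ⟩
    two ℚ.* ((ℤ.+ 3 ℚ./ 1 ℚ.+ s) ℚ.* ½) ℚ.- ℤ.+ 3 ℚ./ 1   ≡⟨ halve s ⟩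
    s                                              ∎
    where
    double : ∀ x ε → let β = x ℚ.+ ½ ℚ.* ε ℚ.- 1ℚ in β ℚ.+ β ℚ.- 1ℚ ℚ.+ ε ≡ two ℚ.* (x ℚ.+ ε) ℚ.- ℤ.+ 3 ℚ./ 1
    double = solve 2 (λ x ε → let β = x :+ con ½ :* ε :- con 1ℚ in
      β :+ β :- con 1ℚ :+ ε := con two :* (x :+ ε) :- con (ℤ.+ 3 ℚ./ 1)) refl
    halve : ∀ s → two ℚ.* ((ℤ.+ 3 ℚ./ 1 ℚ.+ s) ℚ.* ½) ℚ.- ℤ.+ 3 ℚ./ 1 ≡ s
    halve = solve 1 (λ s → con two :* ((con (ℤ.+ 3 ℚ./ 1) :+ s) :* con ½) :- con (ℤ.+ 3 ℚ./ 1) := s) refl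
  choose : ∃[ β ] 1ℚ ℚ.≤ β × β ℚ.* β ℚ.< β ℚ.+ 1ℚ × Eventually (λ k → seq α k ℚ.≤ 1ℚ ℚ.+ β)
  -- A `β` below 1 is raised to 1, which still satisfies `β² < β + 1` and only weakens the bound on
  -- `α`.
  choose with ℚ.≤-total 1ℚ β
  ... | inj₁ 1≤β = β , 1≤β , below-golden 1≤β t<s (y²≤5 m) , N , α≤
  ... | inj₂ β≤1 = 1ℚ , ℚ.≤-refl , ℚ.+-monoʳ-< 1ℚ (ℚ.positive⁻¹ 1ℚ) , N ,
    λ k N≤k → ℚ.≤-trans (α≤ k N≤k) (ℚ.+-monoʳ-≤ 1ℚ β≤1)

-- The gap `ε` between `1/α` and `r` serves as `η`: multiplying it by `1 + β ≥ 1` does not shrink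
-- it, while `1/α` times `1 + β` is eventually at least 1.
inverse-bound : ∀ α (0<α : 0ℝ < α) r {β} → 1/⟨ α , 0<α ⟩ < r → 1ℚ ℚ.≤ β →
  Eventually (λ k → seq α k ℚ.≤ 1ℚ ℚ.+ β) →
  ∃[ η ] 0ℚ ℚ.< η × Eventually (λ k → 0ℚ ℚ.≤ seq r k × 1ℚ ℚ.+ η ℚ.≤ seq r k ℚ.* (1ℚ ℚ.+ β))
inverse-bound α (δ , 0<δ , M , δ≤) r {β} (ε , 0<ε , N , h) 1≤β (K , α≤) =
  ε , 0<ε , M ℕ.⊔ (N ℕ.⊔ K) , λ k le → bounds k
    (ℕ.m⊔n≤o⇒m≤o M (N ℕ.⊔ K) le)
    (ℕ.m⊔n≤o⇒m≤o N K (ℕ.m⊔n≤o⇒n≤o M (N ℕ.⊔ K) le))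
    (ℕ.m⊔n≤o⇒n≤o N K (ℕ.m⊔n≤o⇒n≤o M (N ℕ.⊔ K) le))
  where
  open ℚ.≤-Reasoning
  bounds : ∀ k → M ℕ.≤ k → N ℕ.≤ k → K ℕ.≤ k → 0ℚ ℚ.≤ seq r k × 1ℚ ℚ.+ ε ℚ.≤ seq r k ℚ.* (1ℚ ℚ.+ β)
  bounds k M≤k N≤k K≤k = 0≤r , (begin
    1ℚ ℚ.+ ε                          ≡⟨ cong₂ ℚ._+_ (ℚ.*-inverseˡ a) (ℚ.*-identityʳ ε) ⟨
    u ℚ.* a ℚ.+ ε ℚ.* 1ℚ              ≤⟨ ℚ.+-mono-≤ (*-monoˡ 0≤u a≤) (*-monoˡ (ℚ.<⇒≤ 0<ε) (ℚ.+-mono-≤ {1ℚ} {1ℚ} {0ℚ} ℚ.≤-refl (ℚ.≤-trans (ℚ.nonNegative⁻¹ 1ℚ) 1≤β))) ⟩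
    u ℚ.* (1ℚ ℚ.+ β) ℚ.+ ε ℚ.* (1ℚ ℚ.+ β)  ≡⟨ ℚ.*-distribʳ-+ (1ℚ ℚ.+ β) u ε ⟨
    (u ℚ.+ ε) ℚ.* (1ℚ ℚ.+ β)          ≤⟨ *-monoʳ 0≤α (h k N≤k) ⟩
    seq r k ℚ.* (1ℚ ℚ.+ β)            ∎)
    where
    a : ℚ
    -- This is the truncation inverted in `1/⟨_,_⟩`, so that `h` is a bound on `u + ε`.
    a = δ ℚ.⊔ seq α k
    0<a : 0ℚ ℚ.< a
    0<a = ℚ.<-≤-trans 0<δ (ℚ.p≤p⊔q δ (seq α k))
    instance _ = ℚ.>-nonZero 0<a
    u : ℚ
    u = ℚ.1/ a
    0≤u : 0ℚ ℚ.≤ u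
    0≤u = ℚ.<⇒≤ (ℚ.positive⁻¹ u {{ℚ.1/pos⇒pos a {{ℚ.positive 0<a}}}})
    0≤α : 0ℚ ℚ.≤ 1ℚ ℚ.+ β
    0≤α = ℚ.+-mono-≤ (ℚ.nonNegative⁻¹ 1ℚ) (ℚ.≤-trans (ℚ.nonNegative⁻¹ 1ℚ) 1≤β)
    0≤r : 0ℚ ℚ.≤ seq r k
    0≤r = ℚ.≤-trans (ℚ.+-mono-≤ 0≤u (ℚ.<⇒≤ 0<ε)) (h k N≤k)
    δ≤α : δ ℚ.≤ seq α k
    δ≤α = subst (ℚ._≤ seq α k) (ℚ.+-identityˡ δ) (δ≤ k M≤k)
    a≤ : a ℚ.≤ 1ℚ ℚ.+ β
    a≤ = ℚ.⊔-lub (ℚ.≤-trans δ≤α (α≤ k K≤k)) (α≤ k K≤k)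

-- Responses of the algorithm and the adversary's bookkeeping.

unique-resp-↭ : {xs ys : List X} → xs ↭ ys → Unique xs → Unique ys
unique-resp-↭ {X} p = Unique-resp-↭ (setoid X) (↭⇒↭ₛ p)

total-++ : ∀ us {vs} → total (us ++ vs) ≡ total us ℚ.+ total vs
total-++ []       {vs} = sym (ℚ.+-identityˡ (total vs))
total-++ (u ∷ us) {vs} = trans (cong (weight u ℚ.+_) (total-++ us)) (sym (ℚ.+-assoc (weight u) (total us) (total vs)))

weight-nonNeg : ∀ {q i} → 0ℚ ℚ.≤ q → weight (q , i) ≡ q
weight-nonNeg = ℚ.0≤p⇒∣p∣≡p

Below : ℕ → Ω → Set
Below M ((_ , i) , p) = i ℕ.< M × p ℕ.< M

select-∷⁻ : ∀ (e : X) {x} (es : Vec X n) b S R → x ∈ select (e ∷ es) (b ∷ (S ─ R)) → x ≡ e ⊎ x ∈ select es S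
select-∷⁻ e es true  S R (here refl) = inj₁ refl
select-∷⁻ e es true  S R (there x∈)  = inj₂ (select-─ es S R x∈)
select-∷⁻ e es false S R x∈          = inj₂ (select-─ es S R x∈)

-- This is the case split the adversary reacts to. Removed elements never return, so a refusal
-- leaves the algorithm with no more than it had.
select-∷-response : ∀ (e : X) (es : Vec X n) b S R →
  e ∈ select (e ∷ es) (b ∷ (S ─ R)) ⊎ select (e ∷ es) (b ∷ (S ─ R)) ⊆ select es S
select-∷-response e es true  S R = inj₁ (here refl)
select-∷-response e es false S R = inj₂ (select-─ es S R)

-- M bounds the labels and parts in use; L is a matching of items lost to the
-- algorithm to parts, and H the other items of interest.
record Board (M : ℕ) {n} (es : Vec Ω n) (H : List Item) (L : List Ω) : Set where
  constructor board
  field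
    distinct : Distinct es
    below    : VecAll.All (Below M) es
    arrived  : All (Vec._∈ es) L
    parts    : Unique (map proj₂ L)
    items    : Unique (H ++ map proj₁ L)
    known    : All (λ u → proj₂ u ℕ.< M) H

  fresh-part : M ∉ map proj₂ L
  fresh-part M∈ with ∈-map⁻ proj₂ M∈
  ... | e , e∈ , refl = ℕ.<-irrefl refl (proj₂ (lookup below (All.lookup arrived e∈)))

  fresh-item : ∀ q → (q , M) ∉ H ++ map proj₁ L
  fresh-item q u∈ with ∈-++⁻ H u∈
  ... | inj₁ u∈H = ℕ.<-irrefl refl (All.lookup known u∈H)
  ... | inj₂ u∈L with ∈-map⁻ proj₁ u∈L
  ...   | e , e∈ , refl = ℕ.<-irrefl refl (proj₁ (lookup below (All.lookup arrived e∈)))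

  new-item : ∀ {q p} → VecAll.All (((q , M) , p) ≢_) es
  new-item = VecAll.map (λ { b refl → ℕ.<-irrefl refl (proj₁ b) }) below

  new-part : ∀ {u} → VecAll.All ((u , M) ≢_) es
  new-part = VecAll.map (λ { b refl → ℕ.<-irrefl refl (proj₂ b) }) below

  below-suc : VecAll.All (Below (suc M)) es
  below-suc = VecAll.map (λ { (i< , p<) → ℕ.m≤n⇒m≤1+n i< , ℕ.m≤n⇒m≤1+n p< }) below

  known-suc : All (λ u → proj₂ u ℕ.< suc M) H
  known-suc = All.map ℕ.m≤n⇒m≤1+n known

open Board

-- The game against an algorithm known only through `held`.

module Game
  (β : ℚ) (1≤β : 1ℚ ℚ.≤ β) (β²<β+1 : β ℚ.* β ℚ.< β ℚ.+ 1ℚ)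
  (held : ∀ {n} → Vec Ω n → List Ω)
  (held-[] : ∀ {x} → x ∉ held [])
  (held-∷ : ∀ {n} e (es : Vec Ω n) {x} → x ∈ held (e ∷ es) → x ≡ e ⊎ x ∈ held es)
  (response : ∀ {n} e (es : Vec Ω n) → e ∈ held (e ∷ es) ⊎ held (e ∷ es) ⊆ held es)
  (held-injective : ∀ {n} {es : Vec Ω n} → Distinct es →
    ∀ {x y} → x ∈ held es → y ∈ held es → proj₂ x ≡ proj₂ y → x ≡ y)
  -- `H` covers what is held and `W` is a feasible solution; a pair with `W` worth at least `1 + β`
  -- times `H` would refute the ratio.
  (competitive : ∀ {n} {es : Vec Ω n} → Distinct es → ∀ H W → map proj₁ (held es) ⊆ H →
    All (Vec._∈ es) W → Unique (map proj₂ W) → Unique (map proj₁ W) →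
    0ℚ ℚ.< total H → ¬ ((1ℚ ℚ.+ β) ℚ.* total H ℚ.≤ total (map proj₁ W)))
  where

  α : ℚ
  α = 1ℚ ℚ.+ β

  -- All items the algorithm might hold are offered again in fresh parts, where
  -- they are worthless to the algorithm but free the old parts for lost items.
  finish : ∀ {M} {es : Vec Ω n} {H W} todo → Board M es todo W → map proj₁ (held es) ⊆ H → todo ⊆ H →
           0ℚ ℚ.< total H → ¬ (α ℚ.* total H ℚ.≤ total (todo ++ map proj₁ W))
  finish {H = H} {W} [] b sub _ pos le = competitive (distinct b) H W sub (arrived b) (parts b) (items b) pos le
  finish {M = M} {es = es} {H} {W} (u ∷ todo) b sub sub′ pos le =
    finish todo
      (board (new-part b ∷ distinct b) ((ℕ.m≤n⇒m≤1+n (All.lookup (known b) (here refl)) , ℕ.n<1+n M) ∷ below-suc b)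
        (here refl ∷ All.map there (arrived b))
        (unique-∷⁺ (fresh-part b) (parts b))
        (unique-resp-↭ (↭-sym (shift u todo (map proj₁ W))) (items b))
        (All.tail (known-suc b)))
      sub₁ (sub′ ∘ there) pos
      (subst (α ℚ.* total H ℚ.≤_) (sym (total-insert todo)) le)
    where
    sub₁ : map proj₁ (held ((u , M) ∷ es)) ⊆ H
    sub₁ v∈ with ∈-map⁻ proj₁ v∈
    ... | x , x∈ , refl with held-∷ (u , M) es x∈
    ...   | inj₁ refl = sub′ (here refl)
    ...   | inj₂ x∈es = sub (∈-map⁺ proj₁ x∈es)

  -- The chain starts with weight α² so that z - α S = α² throughout, which also
  -- expresses P and the next value of S in terms of the last two values of S.
  chainWeight : ℚ → ℚ
  chainWeight S = α ℚ.* α ℚ.+ α ℚ.* S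

  lostWeight : ℚ → ℚ → ℚ
  lostWeight U S = α ℚ.* α ℚ.* (U ℚ.+ β) ℚ.- S

  next : ℚ → ℚ → ℚ
  next U S = (1ℚ ℚ.+ α ℚ.* β) ℚ.* S ℚ.- α ℚ.* α ℚ.* (U ℚ.+ 1ℚ)

  0≤α : 0ℚ ℚ.≤ α
  0≤α = ℚ.+-mono-≤ (ℚ.nonNegative⁻¹ 1ℚ) (ℚ.≤-trans (ℚ.nonNegative⁻¹ 1ℚ) 1≤β)

  0<α : 0ℚ ℚ.< α
  0<α = ℚ.+-mono-<-≤ (ℚ.positive⁻¹ 1ℚ) (ℚ.≤-trans (ℚ.nonNegative⁻¹ 1ℚ) 1≤β)

  chainWeight>0 : ∀ {S} → 0ℚ ℚ.≤ S → 0ℚ ℚ.< chainWeight S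
  chainWeight>0 {S} 0≤S = ℚ.+-mono-<-≤
    (ℚ.positive⁻¹ (α ℚ.* α) {{ℚ.pos*pos⇒pos α {{ℚ.positive 0<α}} α {{ℚ.positive 0<α}}}})
    (ℚ.nonNegative⁻¹ (α ℚ.* S) {{ℚ.nonNeg*nonNeg⇒nonNeg α {{ℚ.nonNegative 0≤α}} S {{ℚ.nonNegative 0≤S}}}})

  -- c is the current item of the chain in part 0, A the fillers held elsewhere;
  -- U and S are the totals of the fillers before and after the last stage.
  record State (U S : ℚ) : Set where
    constructor state
    field
      {bound size} : ℕ
      {es}    : Vec Ω size
      {c}     : Item
      {A}     : List Item
      {L}     : List Ω
      arena   : Board bound es (c ∷ A) L
      outer   : All (λ e → 0 ≢ proj₂ e) L
      base    : (c , 0) Vec.∈ es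
      only    : ∀ {x} → x ∈ held es → x ≡ (c , 0) ⊎ proj₁ x ∈ A
      weightc : weight c ≡ chainWeight S
      totalA  : total A ≡ S
      totalL  : total (map proj₁ L) ≡ lostWeight U S

  -- After a second item of the same weight in part 0, the one that the algorithm
  -- does not keep is c′, which an optimal solution can place in part 0.
  record Twin (U S : ℚ) : Set where
    field
      {c′}     : Item
      current  : State U S
    open State current public
    field
      arena′   : Board bound es (c ∷ A) ((c′ , 0) ∷ L)
      weightc′ : weight c′ ≡ chainWeight S

  -- The two items have equal weight, so it does not matter which one stays: on acceptance `c` and
  -- `c′` exchange roles, on refusal `c` remains current.
  offer-twin : ∀ {U S} → 0ℚ ℚ.≤ S → State U S → Twin U S
  offer-twin {U} {S} 0≤S (state {M} {n} {es} {c} {A} {L} b outer base only wc tA tL)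
    with response ((chainWeight S , M) , 0) es
  ... | inj₁ accepted = record
    { c′ = c
    ; current = state
        (board (new-item b ∷ distinct b) below′ (All.map there (arrived b)) (parts b) (Unique.drop⁺ 1 items″) known′)
        outer (here refl) only′ w′ tA tL
    ; arena′ = board (new-item b ∷ distinct b) below′ (there base ∷ All.map there (arrived b)) parts′ items′ known′
    ; weightc′ = wc
    }
    where
    c′ = (chainWeight S , M)
    w′ : weight c′ ≡ chainWeight S
    w′ = weight-nonNeg {i = M} (ℚ.<⇒≤ (chainWeight>0 0≤S))
    below′ : VecAll.All (Below (suc M)) ((c′ , 0) ∷ es)
    below′ = (ℕ.n<1+n M , ℕ.s≤s ℕ.z≤n) ∷ below-suc b
    known′ : All (λ u → proj₂ u ℕ.< suc M) (c′ ∷ A)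
    known′ = ℕ.n<1+n M ∷ All.tail (known-suc b)
    parts′ : Unique (0 ∷ map proj₂ L)
    parts′ = All.map⁺ outer ∷ parts b
    items₀ : Unique (c′ ∷ c ∷ A ++ map proj₁ L)
    items₀ = unique-∷⁺ (fresh-item b (chainWeight S)) (items b)
    items′ : Unique (c′ ∷ A ++ c ∷ map proj₁ L)
    items′ = unique-resp-↭ (↭-prep c′ (↭-sym (shift c A (map proj₁ L)))) items₀
    items″ : Unique (c ∷ c′ ∷ A ++ map proj₁ L)
    items″ = unique-resp-↭ (shift c (c′ ∷ []) (A ++ map proj₁ L)) items₀
    only′ : ∀ {x} → x ∈ held ((c′ , 0) ∷ es) → x ≡ (c′ , 0) ⊎ proj₁ x ∈ A
    only′ x∈ with held-∷ (c′ , 0) es x∈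
    ... | inj₁ refl = inj₁ refl
    ... | inj₂ x∈es with only x∈es
    -- Part 0 has room for one element, so accepting `c′` evicts `c` from it.
    ...   | inj₁ refl = inj₁ (held-injective (new-item b ∷ distinct b) x∈ accepted refl)
    ...   | inj₂ x∈A  = inj₂ x∈A
  ... | inj₂ refused = record
    { c′ = c′
    ; current = state
        (board (new-item b ∷ distinct b) below′ (All.map there (arrived b)) (parts b) (items b) (known-suc b))
        outer (there base) (only ∘ refused) wc tA tL
    ; arena′ = board (new-item b ∷ distinct b) below′ (here refl ∷ All.map there (arrived b)) (All.map⁺ outer ∷ parts b)
        (unique-resp-↭ (↭-sym (shift c′ (c ∷ A) (map proj₁ L))) (unique-∷⁺ (fresh-item b (chainWeight S)) (items b))) (known-suc b)
    ; weightc′ = weight-nonNeg {i = M} (ℚ.<⇒≤ (chainWeight>0 0≤S))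
    }
    where
    c′ = (chainWeight S , M)
    below′ : VecAll.All (Below (suc M)) ((c′ , 0) ∷ es)
    below′ = (ℕ.n<1+n M , ℕ.s≤s ℕ.z≤n) ∷ below-suc b

  module Identities where
    open +-*-Solver

    :α : Polynomial n → Polynomial n
    :α b = con 1ℚ :+ b

    :z : Polynomial n → Polynomial n → Polynomial n
    :z b S = :α b :* :α b :+ :α b :* S

    :P :next : Polynomial n → Polynomial n → Polynomial n → Polynomial n
    :P b U S    = :α b :* :α b :* (U :+ b) :- S
    :next b U S = (con 1ℚ :+ :α b :* b) :* S :- :α b :* :α b :* (U :+ con 1ℚ)

    -- The first threat, with equality: against `z + S` held, the optimum has the same items in
    -- fresh parts, the filler, the twin in part 0 and the lost items.
    balance : ∀ U S → α ℚ.* (chainWeight S ℚ.+ S) ≡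
      (chainWeight S ℚ.+ S) ℚ.+ ((next U S ℚ.- S) ℚ.+ (chainWeight S ℚ.+ lostWeight U S))
    balance = solve 3 (λ b U S →
      :α b :* (:z b S :+ S) := (:z b S :+ S) :+ ((:next b U S :- S) :+ (:z b S :+ :P b U S))) refl β

    -- The second threat, with equality: if the next chain item is refused, the optimum places it in
    -- part 0 in addition to the held and the lost items.
    balance-refusal : ∀ U S → let S′ = next U S in α ℚ.* (chainWeight S ℚ.+ S′) ≡
      (chainWeight S ℚ.+ S′) ℚ.+ (chainWeight S′ ℚ.+ lostWeight U S)
    balance-refusal = solve 3 (λ b U S →
      let S′ = :next b U S
      in :α b :* (:z b S :+ S′) := (:z b S :+ S′) :+ (:z b S′ :+ :P b U S)) refl β

    lostWeight-step : ∀ U S → chainWeight S ℚ.+ lostWeight U S ≡ lostWeight S (next U S)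
    lostWeight-step = solve 3 (λ b U S →
      :z b S :+ :P b U S := :P b S (:next b U S)) refl β

    -- `next` is affine, so differences cancel its constant and obey the homogeneous recurrence
    -- treated in `increment-ratio`.
    next-increment : ∀ U S S′ → next S S′ ℚ.- next U S ≡
      (1ℚ ℚ.+ α ℚ.* β) ℚ.* (S′ ℚ.- S) ℚ.- α ℚ.* α ℚ.* (S ℚ.- U)
    next-increment = solve 4 (λ b U S S′ →
      :next b S S′ :- :next b U S := (con 1ℚ :+ :α b :* b) :* (S′ :- S) :- :α b :* :α b :* (S :- U)) refl β

  open Identities using (balance; balance-refusal; lostWeight-step; next-increment)

  total>0 : ∀ {c S} A → weight c ≡ chainWeight S → 0ℚ ℚ.≤ S → 0ℚ ℚ.< total (c ∷ A)
  total>0 A wc 0≤S = ℚ.+-mono-<-≤ (subst (0ℚ ℚ.<_) (sym wc) (chainWeight>0 0≤S)) (total≥0 A)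

  stop : ∀ {U S} → 0ℚ ℚ.≤ S → next U S ℚ.≤ S → ¬ Twin U S
  stop {U} {S} 0≤S S′≤S tw = finish (c ∷ A) arena′ sub id (total>0 {c} A weightc 0≤S) (begin
    α ℚ.* total (c ∷ A)
      ≡⟨ cong (α ℚ.*_) hold ⟩
    α ℚ.* (chainWeight S ℚ.+ S)
      ≡⟨ balance U S ⟩
    (chainWeight S ℚ.+ S) ℚ.+ ((next U S ℚ.- S) ℚ.+ (chainWeight S ℚ.+ lostWeight U S))
      ≤⟨ ℚ.+-monoʳ-≤ (chainWeight S ℚ.+ S) (ℚ.+-monoˡ-≤ (chainWeight S ℚ.+ lostWeight U S) (p≤q⇒p-q≤0 S′≤S)) ⟩
    (chainWeight S ℚ.+ S) ℚ.+ (0ℚ ℚ.+ (chainWeight S ℚ.+ lostWeight U S))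
      ≡⟨ cong₂ ℚ._+_ (sym hold) (trans (ℚ.+-identityˡ _) (cong₂ ℚ._+_ (sym weightc′) (sym totalL))) ⟩
    total (c ∷ A) ℚ.+ total (c′ ∷ map proj₁ L)
      ≡⟨ total-++ (c ∷ A) ⟨
    total ((c ∷ A) ++ c′ ∷ map proj₁ L) ∎)
    where
    open Twin tw
    open ℚ.≤-Reasoning
    hold : total (c ∷ A) ≡ chainWeight S ℚ.+ S
    hold = cong₂ ℚ._+_ weightc totalA
    sub : map proj₁ (held es) ⊆ c ∷ A
    sub u∈ with ∈-map⁻ proj₁ u∈
    ... | x , x∈ , refl with only x∈
    ...   | inj₁ refl = here refl
    ...   | inj₂ x∈A  = there x∈A

  advance : ∀ {U S} → 0ℚ ℚ.≤ S → S ℚ.< next U S → Twin U S → State S (next U S)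
  advance {U} {S} 0≤S S<S′ tw = offer-filler (response e₂ es₁)
    where
    open Twin tw
    open ℚ.≤-Reasoning
    S′ : ℚ
    S′ = next U S
    M M′ : ℕ
    M  = bound
    M′ = suc bound
    a z : Item
    a = (S′ ℚ.- S , M)
    z = (chainWeight S′ , M′)
    e₁ e₂ e₃ : Ω
    e₁ = (a , M)
    e₂ = (c , M)
    e₃ = (z , 0)
    es₁ : Vec Ω (suc size)
    es₁ = e₁ ∷ es
    es₂ : Vec Ω (suc (suc size))
    es₂ = e₂ ∷ es₁
    es₃ : Vec Ω (suc (suc (suc size)))
    es₃ = e₃ ∷ es₂
    0≤S′ : 0ℚ ℚ.≤ S′
    0≤S′ = ℚ.≤-trans 0≤S (ℚ.<⇒≤ S<S′)
    weighta : weight a ≡ S′ ℚ.- S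
    weighta = weight-nonNeg {i = M} (p≤q⇒0≤q-p (ℚ.<⇒≤ S<S′))
    weightz : weight z ≡ chainWeight S′
    weightz = weight-nonNeg {i = M′} (ℚ.<⇒≤ (chainWeight>0 0≤S′))
    totalA′ : total (a ∷ A) ≡ S′
    totalA′ = trans (cong₂ ℚ._+_ weighta totalA) (solve 2 (λ x y → x :- y :+ y := x) refl S′ S)
      where open +-*-Solver

    a∉ : a ∉ (c ∷ A) ++ map proj₁ L
    a∉ = fresh-item arena (S′ ℚ.- S)

    b₂ : Board M′ es₂ (c ∷ a ∷ A) L
    b₂ = board
      (((λ e₂≡e₁ → a∉ (here (sym (cong proj₁ e₂≡e₁)))) ∷ new-part arena) ∷ new-item arena ∷ distinct arena)
      ((All.head (known-suc arena) , ℕ.n<1+n M) ∷ (ℕ.n<1+n M , ℕ.n<1+n M) ∷ below-suc arena)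
      (All.map (λ e∈ → there (there e∈)) (arrived arena))
      (parts arena)
      (unique-resp-↭ (shift c (a ∷ []) (A ++ map proj₁ L)) (unique-∷⁺ a∉ (items arena)))
      (All.head (known-suc arena) ∷ ℕ.n<1+n M ∷ All.tail (known-suc arena))

    only₂ : ∀ {x} → x ∈ held es₂ → x ≡ e₂ ⊎ x ≡ e₁ ⊎ x ≡ (c , 0) ⊎ proj₁ x ∈ A
    only₂ x∈ = map₂ (λ x∈₁ → map₂ only (held-∷ e₁ es x∈₁)) (held-∷ e₂ es₁ x∈)

    offer-filler : e₂ ∈ held es₂ ⊎ held es₂ ⊆ held es₁ → State S S′
    -- Taking `c` in part `M` evicts the filler `a`, which the optimum then uses in part `M`, with
    -- `c′` in part 0.
    offer-filler (inj₁ accepted) = ⊥-elim (finish (c ∷ A) b sub id (total>0 {c} A weightc 0≤S) (begin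
      α ℚ.* total (c ∷ A)
        ≡⟨ cong (α ℚ.*_) hold ⟩
      α ℚ.* (chainWeight S ℚ.+ S)
        ≡⟨ balance U S ⟩
      (chainWeight S ℚ.+ S) ℚ.+ ((next U S ℚ.- S) ℚ.+ (chainWeight S ℚ.+ lostWeight U S))
        ≡⟨ cong₂ ℚ._+_ (sym hold) (cong₂ ℚ._+_ (sym weighta) (cong₂ ℚ._+_ (sym weightc′) (sym totalL))) ⟩
      total (c ∷ A) ℚ.+ total (a ∷ c′ ∷ map proj₁ L)
        ≡⟨ total-++ (c ∷ A) ⟨
      total ((c ∷ A) ++ a ∷ c′ ∷ map proj₁ L) ∎))
      where
      hold : total (c ∷ A) ≡ chainWeight S ℚ.+ S
      hold = cong₂ ℚ._+_ weightc totalA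
      b : Board M′ es₂ (c ∷ A) (e₁ ∷ (c′ , 0) ∷ L)
      b = board (distinct b₂) (below b₂)
        (there (here refl) ∷ All.map (λ e∈ → there (there e∈)) (arrived arena′))
        (unique-∷⁺ (fresh-part arena′) (parts arena′))
        (unique-resp-↭ (↭-sym (shift a (c ∷ A) (c′ ∷ map proj₁ L)))
          (unique-∷⁺ (fresh-item arena′ (S′ ℚ.- S)) (items arena′)))
        (known-suc arena)
      sub : map proj₁ (held es₂) ⊆ c ∷ A
      sub u∈ with ∈-map⁻ proj₁ u∈
      ... | x , x∈ , refl with only₂ x∈
      ...   | inj₁ refl               = here refl
      ...   | inj₂ (inj₁ refl)        = here (cong proj₁ (held-injective (distinct b₂) x∈ accepted refl))
      ...   | inj₂ (inj₂ (inj₁ refl)) = here refl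
      ...   | inj₂ (inj₂ (inj₂ x∈A))  = there x∈A
    offer-filler (inj₂ refused) = offer-chain (response e₃ es₂)
      where
      only₂′ : ∀ {x} → x ∈ held es₂ → x ≡ (c , 0) ⊎ proj₁ x ∈ a ∷ A
      only₂′ x∈ with held-∷ e₁ es (refused x∈)
      ... | inj₁ refl = inj₂ (here refl)
      ... | inj₂ x∈es = map₂ there (only x∈es)

      below₃ : VecAll.All (Below (suc M′)) es₃
      below₃ = (ℕ.n<1+n M′ , ℕ.s≤s ℕ.z≤n) ∷ below-suc b₂

      items₃ : Unique (z ∷ c ∷ a ∷ A ++ map proj₁ L)
      items₃ = unique-∷⁺ (fresh-item b₂ (chainWeight S′)) (items b₂)

      offer-chain : e₃ ∈ held es₃ ⊎ held es₃ ⊆ held es₂ → State S S′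
      -- Now `z` evicts `c` from part 0, and the refused copy `e₂` extends the lost matching.
      offer-chain (inj₁ accepted) = state
        (board (new-item b₂ ∷ distinct b₂) below₃
          (there (here refl) ∷ All.map there (arrived b₂))
          (unique-∷⁺ (fresh-part arena) (parts arena))
          (unique-resp-↭ (↭-prep z (↭-sym (shift c (a ∷ A) (map proj₁ L)))) items₃)
          (ℕ.n<1+n M′ ∷ All.tail (known-suc b₂)))
        -- `M` exceeds the label of `c`, so the part used for `e₂` is not part 0.
        ((λ 0≡M → ℕ.n≮0 (subst (proj₂ c ℕ.<_) (sym 0≡M) (All.head (known arena)))) ∷ outer)
        (here refl) only₃ weightz totalA′
        (trans (cong₂ ℚ._+_ weightc totalL) (lostWeight-step U S))
        where
        only₃ : ∀ {x} → x ∈ held es₃ → x ≡ e₃ ⊎ proj₁ x ∈ a ∷ A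
        only₃ x∈ with held-∷ e₃ es₂ x∈
        ... | inj₁ x≡e₃ = inj₁ x≡e₃
        ... | inj₂ x∈es₂ with only₂′ x∈es₂
        ...   | inj₁ refl = inj₁ (held-injective (new-item b₂ ∷ distinct b₂) x∈ accepted refl)
        ...   | inj₂ x∈A  = inj₂ x∈A
      -- Here part 0 of the optimum goes to the refused `z` instead of the twin.
      offer-chain (inj₂ refused₃) = ⊥-elim (finish (c ∷ a ∷ A) b sub id (total>0 {c} (a ∷ A) weightc 0≤S) (begin
        α ℚ.* total (c ∷ a ∷ A)
          ≡⟨ cong (α ℚ.*_) hold ⟩
        α ℚ.* (chainWeight S ℚ.+ S′)
          ≡⟨ balance-refusal U S ⟩
        (chainWeight S ℚ.+ S′) ℚ.+ (chainWeight S′ ℚ.+ lostWeight U S)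
          ≡⟨ cong₂ ℚ._+_ (sym hold) (cong₂ ℚ._+_ (sym weightz) (sym totalL)) ⟩
        total (c ∷ a ∷ A) ℚ.+ total (z ∷ map proj₁ L)
          ≡⟨ total-++ (c ∷ a ∷ A) ⟨
        total ((c ∷ a ∷ A) ++ z ∷ map proj₁ L) ∎))
        where
        hold : total (c ∷ a ∷ A) ≡ chainWeight S ℚ.+ S′
        hold = cong₂ ℚ._+_ weightc totalA′
        b : Board (suc M′) es₃ (c ∷ a ∷ A) (e₃ ∷ L)
        b = board (new-item b₂ ∷ distinct b₂) below₃
          (here refl ∷ All.map there (arrived b₂))
          (All.map⁺ outer ∷ parts arena)
          (unique-resp-↭ (↭-sym (shift z (c ∷ a ∷ A) (map proj₁ L))) items₃)
          (known-suc b₂)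
        sub : map proj₁ (held es₃) ⊆ c ∷ a ∷ A
        sub u∈ with ∈-map⁻ proj₁ u∈
        ... | x , x∈ , refl with only₂′ (refused₃ x∈)
        ...   | inj₁ refl = here refl
        ...   | inj₂ x∈A  = there x∈A

  -- The earlier total is fictitious: `- β` makes `lostWeight` vanish, as the empty `L` demands, and
  -- gives a positive first increment `β`.
  opening : State (ℚ.- β) 0ℚ
  opening = state {c = c} {A = []} {L = []}
    (board {M = 1} {es = e ∷ []} ([] ∷ []) ((ℕ.n<1+n 0 , ℕ.n<1+n 0) ∷ []) [] [] ([] ∷ []) (ℕ.n<1+n 0 ∷ []))
    [] (here refl) (λ x∈ → map₂ (⊥-elim ∘ held-[]) (held-∷ e [] x∈))
    (weight-nonNeg {i = 0} (ℚ.<⇒≤ (chainWeight>0 ℚ.≤-refl)))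
    refl (solve 1 (λ b → con 0ℚ := (con 1ℚ :+ b) :* (con 1ℚ :+ b) :* (:- b :+ b) :- con 0ℚ) refl β)
    where
    open +-*-Solver
    c : Item
    c = (chainWeight 0ℚ , 0)
    e : Ω
    e = (c , 0)

  -- Termination of the game.

  δ : ℚ
  δ = β ℚ.+ 1ℚ ℚ.- β ℚ.* β

  -- The ratio of consecutive increments is at most `k ⋆ δ` and drops by `δ` in each round. So after
  -- at most `k` rounds the increment is no longer positive and `stop` applies.
  play : ∀ k {U S} → 0ℚ ℚ.≤ S → U ℚ.< S → next U S ℚ.- S ℚ.≤ k ⋆ δ ℚ.* (S ℚ.- U) → ¬ State U S
  play k {U} {S} 0≤S U<S slow st = move k slow (next U S ℚ.≤? S)
    where
    move : ∀ k → next U S ℚ.- S ℚ.≤ k ⋆ δ ℚ.* (S ℚ.- U) → Dec (next U S ℚ.≤ S) → ⊥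
    move _       _    (yes S′≤S) = stop 0≤S S′≤S (offer-twin 0≤S st)
    move zero    slow (no S′≰S)  = ℚ.<-irrefl refl (ℚ.<-≤-trans (p<q⇒0<q-p (ℚ.≰⇒> S′≰S))
      (subst (next U S ℚ.- S ℚ.≤_) (ℚ.*-zeroˡ (S ℚ.- U)) slow))
    move (suc k) slow (no S′≰S)  = play k (ℚ.≤-trans 0≤S (ℚ.<⇒≤ S<S′)) S<S′
      (subst (ℚ._≤ k ⋆ δ ℚ.* (next U S ℚ.- S)) (sym (next-increment U S (next U S)))
        -- Used with `κ = k ⋆ δ`, as `suc k ⋆ δ` unfolds to `δ + k ⋆ δ`.
        (increment-ratio β (p<q⇒0<q-p U<S) (p≤q⇒0≤q-p (ℚ.<⇒≤ S<S′)) slow))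
      (advance 0≤S S<S′ (offer-twin 0≤S st))
      where
      S<S′ : S ℚ.< next U S
      S<S′ = ℚ.≰⇒> S′≰S

  impossible : ⊥
  impossible with archimedean (next (ℚ.- β) 0ℚ ℚ.- 0ℚ) (p<q⇒0<q-p β²<β+1)
  ... | k , ≤k⋆δ = play k ℚ.≤-refl (ℚ.neg-antimono-< 0<β) (begin
    next (ℚ.- β) 0ℚ ℚ.- 0ℚ        ≤⟨ ≤k⋆δ ⟩
    k ⋆ δ                         ≡⟨ ℚ.*-identityʳ (k ⋆ δ) ⟨
    -- The fictitious first increment `β` is at least 1, so `k ⋆ δ` also bounds the initial ratio.
    k ⋆ δ ℚ.* 1ℚ                  ≤⟨ *-monoˡ (⋆-nonNeg k (ℚ.<⇒≤ (p<q⇒0<q-p β²<β+1))) 1≤β ⟩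
    k ⋆ δ ℚ.* β                   ≡⟨ cong (k ⋆ δ ℚ.*_) (solve 1 (λ b → b := con 0ℚ :- (:- b)) refl β) ⟩
    k ⋆ δ ℚ.* (0ℚ ℚ.- (ℚ.- β))    ∎) opening
    where
    open ℚ.≤-Reasoning
    open +-*-Solver
    0<β : 0ℚ ℚ.< β
    0<β = ℚ.<-≤-trans (ℚ.positive⁻¹ 1ℚ) 1≤β

-- Playing the game against an actual algorithm.

module _ (𝒜 : Algorithm) where
  open Algorithm 𝒜

  held : ∀ {n} → Vec Ω n → List Ω
  held es = select es (run strategy I es)

  decision : ∀ {n} → Vec Ω (suc n) → Subset n × Bool
  decision es@(_ ∷ es₀) = strategy (f I es) (λ T → does (independent? I es T)) (run strategy I es₀)

  held-∷ : ∀ {n} e (es : Vec Ω n) {x} → x ∈ held (e ∷ es) → x ≡ e ⊎ x ∈ held es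
  held-∷ e es = select-∷⁻ e es (proj₂ (decision (e ∷ es))) (run strategy I es) (proj₁ (decision (e ∷ es)))

  response : ∀ {n} e (es : Vec Ω n) → e ∈ held (e ∷ es) ⊎ held (e ∷ es) ⊆ held es
  response e es = select-∷-response e es (proj₂ (decision (e ∷ es))) (run strategy I es) (proj₁ (decision (e ∷ es)))

  held-injective : ∀ {n} {es : Vec Ω n} → Distinct es → ∀ {x y} → x ∈ held es → y ∈ held es → proj₂ x ≡ proj₂ y → x ≡ y
  held-injective {es = es} uniq = independent-injective {es = es} (run strategy I es) (independent I es uniq)

  -- With `h` the total of `H`, the ratio forces `(1 + η) h ≤ r α h ≤ r f(OPT) ≤ h` up to an
  -- arbitrary error, which is absurd for `h > 0`.
  no-certificate : ∀ r α η → 0ℚ ℚ.< η → Eventually (λ k → 0ℚ ℚ.≤ seq r k × 1ℚ ℚ.+ η ℚ.≤ seq r k ℚ.* α) →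
    HasCompetitiveRatio 𝒜 r → ∀ {n} {es : Vec Ω n} → Distinct es → ∀ H W → map proj₁ (held es) ⊆ H →
    All (Vec._∈ es) W → Unique (map proj₂ W) → Unique (map proj₁ W) →
    0ℚ ℚ.< total H → ¬ (α ℚ.* total H ℚ.≤ total (map proj₁ W))
  no-certificate r α η 0<η (M , large) ratio {es = es} distinct H W sub arrived parts items 0<H αH≤W =
    ℚ.<-irrefl refl (ℚ.<-≤-trans (ℚ.+-monoʳ-< h (ℚ.*-monoˡ-<-pos h {{ℚ.positive 0<H}} ½η<η))
      (chain (opt-exists distinct W arrived parts items)))
    where
    open ℚ.≤-Reasoning
    h ε : ℚ
    h = total H
    -- Inequality of reals holds only up to a positive error; half of the surplus `η h` still leaves
    -- a contradiction.
    ε = ½ ℚ.* η ℚ.* h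
    ½<1 : ½ ℚ.< 1ℚ
    ½<1 = ℚ.*<* (ℤ.+<+ (ℕ.s≤s (ℕ.s≤s ℕ.z≤n)))
    ½η<η : ½ ℚ.* η ℚ.< η
    ½η<η = subst (½ ℚ.* η ℚ.<_) (ℚ.*-identityˡ η) (ℚ.*-monoˡ-<-pos η {{ℚ.positive 0<η}} ½<1)
    chain : ∃[ T ] IsOPT I es T × total (map proj₁ W) ℚ.≤ value es T → h ℚ.+ η ℚ.* h ℚ.≤ h ℚ.+ ε
    chain (T , opt , W≤T) = begin
      h ℚ.+ η ℚ.* h                                ≡⟨ cong (ℚ._+ η ℚ.* h) (ℚ.*-identityˡ h) ⟨
      1ℚ ℚ.* h ℚ.+ η ℚ.* h                         ≡⟨ ℚ.*-distribʳ-+ h 1ℚ η ⟨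
      (1ℚ ℚ.+ η) ℚ.* h                             ≤⟨ *-monoʳ (ℚ.<⇒≤ 0<H) (proj₂ (large k (ℕ.m≤m⊔n M _))) ⟩
      seq r k ℚ.* α ℚ.* h                          ≡⟨ ℚ.*-assoc (seq r k) α h ⟩
      seq r k ℚ.* (α ℚ.* h)                        ≤⟨ *-monoˡ (proj₁ (large k (ℕ.m≤m⊔n M _))) (ℚ.≤-trans αH≤W W≤T) ⟩
      seq r k ℚ.* value es T                       ≡⟨ cong (seq r k ℚ.*_) (seq-f es T k) ⟨
      seq r k ℚ.* seq (f I es T) k                 ≤⟨ proj₂ eventually k (ℕ.m≤n⊔m M _) ⟩
      seq (f I es (run strategy I es)) k ℚ.+ ε     ≡⟨ cong (ℚ._+ ε) (seq-f es (run strategy I es) k) ⟩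
      value es (run strategy I es) ℚ.+ ε           ≤⟨ ℚ.+-monoˡ-≤ ε (value≤total es (run strategy I es) sub) ⟩
      h ℚ.+ ε                                      ∎
      where
      eventually : Eventually (λ k → seq (r * f I es T) k ℚ.≤ seq (f I es (run strategy I es)) k ℚ.+ ε)
      eventually = ratio I es distinct T opt ε (*-pos (*-pos (ℚ.positive⁻¹ ½) 0<η) 0<H)
      k : ℕ
      k = M ℕ.⊔ proj₁ eventually

theorem6p2 : (α : ℝ) (α>0 : 0ℝ < α) → α < (fromℕ 3 + √ 5) * fromℚ ½ →
    (A : Algorithm) (r : ℝ) → 1/⟨ α , α>0 ⟩ < r → ¬ HasCompetitiveRatio A r
theorem6p2 α α>0 α<φ² A r 1/α<r ratio =
  let β , 1≤β , β²<β+1 , α≤1+β = rational-bound α (√ 5) (√-square 5) α<φ²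
      η , 0<η , large          = inverse-bound α α>0 r 1/α<r 1≤β α≤1+β
  in Game.impossible β 1≤β β²<β+1 (held A) (λ ()) (held-∷ A) (response A) (held-injective A)
       (no-certificate A r (1ℚ ℚ.+ β) η 0<η large ratio)
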